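{- For every BST $T$ on $n$ keys there is a query sequence $S(T)$ with $$|S(T)|\le\min\Big(3n\big(d(T)-\lfloor\lg n\rfloor+1\big),\ \tfrac32 n(n-1)\Big),$$ in particular $|S(T)|=O(n\cdot d(T))$, such that the following holds. For every initial BST $T_0$ on the same keys and every query sequence $Y$, when $GF$ serves the concatenation $S(T)\circ Y$ starting from $T_0$, the tree it holds right after serving the last query of $S(T)$ is exactly $T$.
   Context: $d(T)$ is the maximum, over nodes $v$, of the number of edges from the root to $v$. $\lg$ is the base-2 logarithm. Binary search tree model. An algorithm serving a query sequence $X=[x_1,\dots,x_m]$ holds a BST $T_{t-1}$ before serving $x_t$, searches $x_t$ from the root, and may then restructure by rotations into $T_t$. Greedy Future ($GF$). After finding $x_t$ in $T_{t-1}$, let $v_1<\dots<v_k$ be the keys on the root-to-$x_t$ path, set $v_0=-\infty$ and $v_{k+1}=+\infty$, and let $R_0,\dots,R_k$ be the subtrees hanging off this path. For each $i$, $\tau(v_i)$ is the smallest $s>t$ with $x_s\in(v_{i-1},v_{i+1})$, or $+\infty$ if there is none. $GF$ rearranges $v_1,\dots,v_k$ as a treap: a BST in key order and a heap in $\tau$, with the smallest $\tau$ at the top. Ties in $\tau$ are broken in favor of the node of smaller depth in $T_{t-1}$. It then reattaches $R_0,\dots,R_k$ unchanged at their unique positions, giving $T_t$. -}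

module Defs where

open import Data.List.Base using (List; []; _∷_; _++_)
import Data.List.Base as List
open import Data.List.Extrema.Nat using (max)
open import Data.Nat.Base using (ℕ; zero; suc; _<_)
import Data.Nat.Properties as ℕ
open import Data.Product.Base using (_×_; _,_)
open import Data.Product.Relation.Binary.Lex.Strict using (×-Lex; ×-decidable)
open import Data.Tree.Binary using (Tree; leaf; node; module Infix)
open import Data.Tree.Binary.Relation.Unary.All using (All)
open import Data.Unit.Base using (⊤)
open import Level using (Level; _⊔_)
import Relation.Binary.Construct.Add.Extrema.Strict as AddExtrema
open import Relation.Binary.Construct.Add.Supremum.Strict _<_ using (_<⁺_; <⁺-dec)
open import Relation.Binary.Core using (Rel)
open import Relation.Binary.Definitions using (Decidable; tri<; tri≈; tri>)
open import Relation.Binary.PropositionalEquality.Core using (_≡_)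
open import Relation.Binary.Structures using (IsStrictTotalOrder)
open import Relation.Nullary.Construct.Add.Extrema using (_±; ⊥±; ⊤±; [_])
open import Relation.Nullary.Construct.Add.Supremum as Supremum using (_⁺; ⊤⁺)
open import Relation.Nullary.Decidable.Core using (yes; no; _×-dec_)
open import Relation.Unary using (U)

private
  variable
    a : Level
    K : Set a

BinTree : Set a → Set a
BinTree K = Tree K ⊤

keys : BinTree K → List K
keys = Infix.toList

-- For every node, the number of edges from the root to it.
nodeDepths : BinTree K → List ℕ
nodeDepths (leaf _)     = []
nodeDepths (node l _ r) = 0 ∷ List.map suc (nodeDepths l ++ nodeDepths r)

-- The value 0 on the empty tree is a junk value.
d : BinTree K → ℕ
d T = max 0 (nodeDepths T)

-- A time, or +∞ (written ⊤⁺).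
Time : Set
Time = ℕ ⁺

-- Heap priority of a node: its τ, and its old depth to break ties.
Priority : Set
Priority = Time × ℕ

-- p ≺ q : a node of priority p has to be above a node of priority q.
_≺_ : Rel Priority _
_≺_ = ×-Lex _≡_ _<⁺_ _<_

_≺?_ : Decidable _≺_
_≺?_ = ×-decidable (Supremum.≡-dec ℕ._≟_) (<⁺-dec ℕ._<?_) ℕ._<?_

module BST {a ℓ} {K : Set a} {_<ₖ_ : Rel K ℓ}
           (isStrictTotalOrder : IsStrictTotalOrder _≡_ _<ₖ_) where

  open IsStrictTotalOrder isStrictTotalOrder using (compare) renaming (_<?_ to _<ₖ?_)
  open AddExtrema _<ₖ_ using (_<±_; <±-dec)

  data IsBST : BinTree K → Set (a ⊔ ℓ) where
    leaf : ∀ {u} → IsBST (leaf u)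
    node : ∀ {l k r} → All (_<ₖ k) U l → All (k <ₖ_) U r →
           IsBST l → IsBST r → IsBST (node l k r)

  -- The search path from the root to x, listed in key order and cut out of the
  -- tree: (R₀ , (v₁ , δ₁ , R₁) ∷ … ∷ (vₖ , δₖ , Rₖ) ∷ []), where δᵢ is the depth
  -- of vᵢ.  The argument δ is the depth of the root of the given subtree.  The
  -- case of leaf only arises when x is not a key.
  searchPath : K → ℕ → BinTree K → BinTree K × List (K × ℕ × BinTree K)
  searchPath x δ (leaf u) = leaf u , []
  searchPath x δ (node l k r) with compare x k
  ... | tri≈ _ _ _ = l , (k , δ , r) ∷ []
  ... | tri< _ _ _ = let R₀ , vs = searchPath x (suc δ) l in R₀ , vs ++ (k , δ , r) ∷ []
  ... | tri> _ _ _ = let R  , vs = searchPath x (suc δ) r in l , (k , δ , R) ∷ vs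

  -- The first time at which the given queries hit the open interval (lo , hi).
  -- Times are relative to the head of the list, so +∞ aside they differ from
  -- absolute times by a constant.
  nextHit : K ± → K ± → List K → Time
  nextHit lo hi []       = ⊤⁺
  nextHit lo hi (y ∷ ys) with <±-dec _<ₖ?_ lo [ y ] ×-dec <±-dec _<ₖ?_ [ y ] hi
  ... | yes _ = Supremum.[ 0 ]
  ... | no  _ with nextHit lo hi ys
  ...   | ⊤⁺             = ⊤⁺
  ...   | Supremum.[ s ] = Supremum.[ suc s ]

  -- A treap on the path nodes; its leaves are the places where the subtrees Rᵢ
  -- get reattached, and carry them.
  Treap : Set a
  Treap = Tree (K × Priority) (BinTree K)

  -- insertLeftmost R v p t extends the treap t by a node v whose key is smaller
  -- than all keys in t, and R hangs off to the left of v.  The new node goes on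
  -- the left spine, directly below all nodes of it that have to be above v.
  insertLeftmost : BinTree K → K → Priority → Treap → Treap
  insertLeftmost R v p (leaf R′) = node (leaf R) (v , p) (leaf R′)
  insertLeftmost R v p (node l (w , q) r) with q ≺? p
  ... | yes _ = node (insertLeftmost R v p l) (w , q) r
  ... | no  _ = node (leaf R) (v , p) (node l (w , q) r)

  nextKey : List (K × ℕ × BinTree K) → K ±
  nextKey []            = ⊤±
  nextKey ((v , _) ∷ _) = [ v ]

  -- The treap on v₁ < … < vₖ with subtrees R₀ , … , Rₖ; lo is the key v₀ before
  -- v₁, and F the queries still to come.
  treap : List K → K ± → BinTree K → List (K × ℕ × BinTree K) → Treap
  treap F lo R []                  = leaf R
  treap F lo R ((v , δ , R′) ∷ vs) =
    insertLeftmost R v (nextHit lo (nextKey vs) F , δ) (treap F [ v ] R′ vs)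

  reattach : Treap → BinTree K
  reattach (leaf R)           = R
  reattach (node l (v , _) r) = node (reattach l) v (reattach r)

  -- Greedy Future serving the query x when the queries F are still to come.  Only
  -- the resulting tree matters: rotations connect any two BSTs on the same keys.
  serve : K → List K → BinTree K → BinTree K
  serve x F T = let R₀ , vs = searchPath x 0 T in reattach (treap F ⊥± R₀ vs)

  -- gf T₀ X t is the tree T_t that Greedy Future, started on T₀ and serving the
  -- sequence X, holds right after the first t queries (all of X if t > |X|).
  gf : BinTree K → List K → ℕ → BinTree K
  gf T X       zero    = T
  gf T []      (suc t) = T
  gf T (x ∷ X) (suc t) = gf (serve x X T) X t

{-# OPTIONS --safe #-}
module Submission where

-- A BST t on the keys of T equals T as soon as no node v of T is, in t, above an
-- end of the open interval (a , b) that the subtree of v spans in T.  Once this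
-- holds for v, it survives every query outside (a , b).  To achieve it for v,
-- after having done so for its descendants, query one end while both ends are on
-- the search path and the future reaches the τ-intervals of both ends before
-- (a , b): then v gets a larger τ than either end.  Two effects make three queries
-- per node sufficient: a key on the current path that is queried next becomes the
-- root, and a key with no smaller key above it has a τ-interval that is unbounded
-- to the left.  In total fewer than 3n queries suffice.

open import Defs
open import Data.List.Base using (List; length; _++_)
open import Data.List.Membership.Propositional using (_∈_)
open import Data.List.Relation.Binary.BagAndSetEquality using (_∼[_]_; set)
open import Data.List.Relation.Unary.All using (All)
open import Data.Nat.Base using (ℕ; _+_; _*_; _∸_; _/_; _⊓_; _≤_; NonZero)
open import Data.Nat.Logarithm using (⌊log₂_⌋)
open import Data.Product.Base using (∃; _×_)
open import Data.Tree.Binary using (#nodes)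
open import Relation.Binary.Core using (Rel)
open import Relation.Binary.PropositionalEquality.Core using (_≡_)
open import Relation.Binary.Structures using (IsStrictTotalOrder)

open import Data.Empty using (⊥; ⊥-elim)
open import Data.List.Base using ([]; _∷_; map)
open import Data.List.Extrema.Nat using (v<max⁺)
open import Data.List.Membership.Propositional.Properties using (∈-++⁺ʳ)
open import Data.List.Properties using (++-assoc; length-++)
import Data.List.Relation.Unary.All as All
import Data.List.Relation.Unary.All.Properties as All
open import Data.List.Relation.Unary.Any using (Any; here; there)
import Data.List.Relation.Unary.Any.Properties as Any
open import Data.Nat.Base as ℕ using (zero; suc)
import Data.Nat.DivMod as ℕ
import Data.Nat.Properties as ℕ
open import Data.Nat.Tactic.RingSolver using (solve-∀)
open import Data.Product.Base using (∃₂; _,_; proj₁; proj₂)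
open import Data.Sum.Base as Sum using (_⊎_; inj₁; inj₂)
open import Data.Tree.Binary using (leaf; node; module Infix)
open import Data.Tree.Binary.Relation.Unary.All using (leaf; node; mapₙ) renaming (All to Allᵗ)
open import Data.Unit.Base using (⊤; tt)
open import Function.Base using (_∘_; id)
open import Function.Bundles using (module Equivalence)
open import Level using (Lift; _⊔_)
import Relation.Binary.Construct.Add.Extrema.Strict as AddExtrema
import Relation.Binary.Construct.Add.Supremum.NonStrict as SupN
import Relation.Binary.Construct.Add.Supremum.Strict as Sup
open import Relation.Binary.Definitions using (tri<; tri≈; tri>)
open import Relation.Binary.PropositionalEquality using (_≢_; refl; sym; trans; cong; cong₂; subst)
open import Relation.Nullary.Construct.Add.Extrema using (_±; ⊥±; ⊤±; [_])
import Relation.Nullary.Construct.Add.Supremum as Supremum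
open import Relation.Nullary.Decidable.Core using (yes; no; _×-dec_)
open import Relation.Nullary.Negation.Core using (¬_; contradiction)
open import Relation.Unary using (U)

open Sup ℕ._<_ using (_<⁺_; [_]<⊤⁺)
open SupN ℕ._≤_ using (_≤⁺_; _≤⊤⁺)

-- GF decides each step by the whole future, but what follows the sequence is arbitrary. So every
-- comparison of two τ on which the proof relies is settled by a query inside the sequence,
-- strictly, and by inclusions between intervals rather than by computing times. Nodes are treated
-- after their descendants because of which queries do damage. The ends of the interval of v lie
-- outside the intervals of all descendants of v, so asking them preserves what was gained below. In
-- contrast, a child of v has v as an end, and asking v falls inside the interval of v. The count of
-- three rests on queries with two roles. Those made for v push v down, and they are also the near
-- future on which the last queries for its children rely. The delicate point is v as an end of a
-- child's interval: its τ-interval has to be hit before the child's, while the two queries after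
-- the call are ends for v and in general not v. The end on the side away from the child hits the
-- τ-interval of v instead, provided that v has no ancestor on that side; the extra query of v
-- before the call arranges this.

-- Times, priorities and futures

≤⁺⇒≯⁺ : ∀ {s t : Time} → s ≤⁺ t → ¬ (t <⁺ s)
≤⁺⇒≯⁺ SupN.[ p ] Sup.[ q ] = ℕ.≤⇒≯ p q

<⁺⇒≤⁺ : ∀ {s t : Time} → s <⁺ t → s ≤⁺ t
<⁺⇒≤⁺ Sup.[ p ]    = SupN.[ ℕ.<⇒≤ p ]
<⁺⇒≤⁺ [ k ]<⊤⁺ = _ ≤⊤⁺

≮⁺⇒≥⁺ : ∀ (s t : Time) → ¬ (s <⁺ t) → t ≤⁺ s
≮⁺⇒≥⁺ Supremum.⊤⁺    t             n = t ≤⊤⁺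
≮⁺⇒≥⁺ Supremum.[ s ] Supremum.⊤⁺   n = contradiction [ s ]<⊤⁺ n
≮⁺⇒≥⁺ Supremum.[ s ] Supremum.[ t ] n = SupN.[ ℕ.≮⇒≥ (n ∘ Sup.[_]) ]

≺⇒≤⁺ : ∀ {p q : Priority} → p ≺ q → proj₁ p ≤⁺ proj₁ q
≺⇒≤⁺ (inj₁ lt)          = <⁺⇒≤⁺ lt
≺⇒≤⁺ (inj₂ (refl , _)) = SupN.≤⁺-reflexive-≡ ℕ._≤_ ℕ.≤-reflexive refl

⊀⇒≥⁺ : ∀ {p q : Priority} → ¬ (p ≺ q) → proj₁ q ≤⁺ proj₁ p
⊀⇒≥⁺ n = ≮⁺⇒≥⁺ _ _ (n ∘ inj₁)

-- Some query satisfies P, and no query up to and including it satisfies Q.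
data Before {a p q} {K : Set a} (P : K → Set p) (Q : K → Set q) : List K → Set (a ⊔ p ⊔ q) where
  here  : ∀ {c F} → P c → ¬ Q c → Before P Q (c ∷ F)
  there : ∀ {c F} → ¬ Q c → Before P Q F → Before P Q (c ∷ F)

Before-map : ∀ {a p q p′ q′} {K : Set a} {P : K → Set p} {Q : K → Set q}
             {P′ : K → Set p′} {Q′ : K → Set q′} {F : List K} →
             (∀ {c} → P c → P′ c) → (∀ {c} → Q′ c → Q c) → Before P Q F → Before P′ Q′ F
Before-map f g (here p ¬q)  = here (f p) (¬q ∘ g)
Before-map f g (there ¬q b) = there (¬q ∘ g) (Before-map f g b)

zipAll : ∀ {a p q r} {K : Set a} {P : K → Set p} {Q : K → Set q} {R : K → Set r} {t : BinTree K} →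
         (∀ {k} → P k → Q k → R k) → Allᵗ P U t → Allᵗ Q U t → Allᵗ R U t
zipAll f (leaf _)       (leaf _)         = leaf _
zipAll f (node l p r) (node l′ q r′) = node (zipAll f l l′) (f p q) (zipAll f r r′)

module _ {a p q} {K : Set a} {P : K → Set p} {Q : K → Set q} where

  before-∈ : ∀ {xs w} → w ∈ xs → All (¬_ ∘ Q) xs → P w → Before P Q xs
  before-∈ (here refl) (¬q All.∷ _)   p = here p ¬q
  before-∈ (there i)   (¬q All.∷ ¬qs) p = there ¬q (before-∈ i ¬qs p)

  before-++ˡ : ∀ {xs F} → Before P Q xs → Before P Q (xs ++ F)
  before-++ˡ (here p ¬q)  = here p ¬q
  before-++ˡ (there ¬q b) = there ¬q (before-++ˡ b)

module GreedyFuture {a ℓ} {K : Set a} {_<_ : Rel K ℓ} (sto : IsStrictTotalOrder _≡_ _<_) where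

  open BST sto
  open IsStrictTotalOrder sto using (compare; irrefl; asym; _<?_) renaming (trans to <-trans)
  open AddExtrema _<_ using (_<±_; <±-dec; <±-trans; <±-asym; [<]-injective; ⊥±<[_]; [_]<⊤±)

  [<] : ∀ {x y} → x < y → [ x ] <± [ y ]
  [<] p = AddExtrema.[ p ]

  -- The next hit of an interval

  In : K ± → K ± → K → Set (a ⊔ ℓ)
  In lo hi c = lo <± [ c ] × [ c ] <± hi

  private
    suc⁺ : Time → Time
    suc⁺ Supremum.⊤⁺    = Supremum.⊤⁺
    suc⁺ Supremum.[ s ] = Supremum.[ suc s ]

    suc⁺-mono : ∀ {s t} → s <⁺ t → suc⁺ s <⁺ suc⁺ t
    suc⁺-mono Sup.[ p ] = Sup.[ ℕ.s≤s p ]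
    suc⁺-mono [ k ]<⊤⁺  = [ suc k ]<⊤⁺

    0<suc⁺ : ∀ t → Supremum.[ 0 ] <⁺ suc⁺ t
    0<suc⁺ Supremum.⊤⁺    = [ 0 ]<⊤⁺
    0<suc⁺ Supremum.[ s ] = Sup.[ ℕ.s≤s ℕ.z≤n ]

    nextHit-in : ∀ {lo hi c F} → In lo hi c → nextHit lo hi (c ∷ F) ≡ Supremum.[ 0 ]
    nextHit-in {lo} {hi} {c} i with <±-dec _<?_ lo [ c ] ×-dec <±-dec _<?_ [ c ] hi
    ... | yes _ = refl
    ... | no ¬i = contradiction i ¬i

    nextHit-out : ∀ {lo hi c F} → ¬ In lo hi c → nextHit lo hi (c ∷ F) ≡ suc⁺ (nextHit lo hi F)
    nextHit-out {lo} {hi} {c} {F} ¬i with <±-dec _<?_ lo [ c ] ×-dec <±-dec _<?_ [ c ] hi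
    ... | yes i = contradiction i ¬i
    ... | no _ with nextHit lo hi F
    ...   | Supremum.⊤⁺    = refl
    ...   | Supremum.[ s ] = refl

  -- `Before` denies the second property up to and including the witness of the first; this makes
  -- the inequality strict, even if the second time is +∞.
  nextHit-< : ∀ {lo hi lo′ hi′ F} → Before (In lo hi) (In lo′ hi′) F →
              nextHit lo hi F <⁺ nextHit lo′ hi′ F
  nextHit-< {lo′ = lo′} {hi′} {c ∷ F} (here i ¬i′)
    rewrite nextHit-in {F = F} i | nextHit-out {F = F} ¬i′ = 0<suc⁺ _
  nextHit-< {lo} {hi} {lo′} {hi′} {c ∷ F} (there ¬i′ b)
    rewrite nextHit-out {F = F} ¬i′ with <±-dec _<?_ lo [ c ] ×-dec <±-dec _<?_ [ c ] hi
  ... | yes i = 0<suc⁺ (nextHit lo′ hi′ F)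
  ... | no ¬i with nextHit lo hi F | nextHit-< {lo} {hi} {lo′} {hi′} {F} b
  ...   | Supremum.⊤⁺    | ()
  ...   | Supremum.[ s ] | lt = suc⁺-mono lt

  -- Ancestors on search paths

  -- Above t y x : the search for x in t visits y.
  data Above : BinTree K → K → K → Set (a ⊔ ℓ) where
    here  : ∀ {l k r x} → Above (node l k r) k x
    left  : ∀ {l k r y x} → x < k → Above l y x → Above (node l k r) y x
    right : ∀ {l k r y x} → k < x → Above r y x → Above (node l k r) y x

  infix 4 _∈ᵗ_
  _∈ᵗ_ : K → BinTree K → Set (a ⊔ ℓ)
  k ∈ᵗ t = Above t k k

  all-above : ∀ {p} {P : K → Set p} {t y x} → Allᵗ P U t → Above t y x → P y
  all-above (node _ p _) here        = p
  all-above (node l _ _) (left _ q)  = all-above l q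
  all-above (node _ _ r) (right _ q) = all-above r q

  all-∈ : ∀ {t} → IsBST t → Allᵗ (_∈ᵗ t) U t
  all-∈ leaf = leaf _
  all-∈ (node l<k k<r bl br) =
    node (zipAll left l<k (all-∈ bl)) here (zipAll right k<r (all-∈ br))

  above-trans : ∀ {t y z x} → IsBST t → Above t y z → Above t z x → Above t y x
  above-trans b here q = here
  above-trans b (left z<k p) here = contradiction z<k (irrefl refl)
  above-trans (node _ _ bl _) (left z<k p) (left x<k q) = left x<k (above-trans bl p q)
  above-trans (node _ k<r _ _) (left z<k p) (right _ q) = contradiction (all-above k<r q) (asym z<k)
  above-trans b (right k<z p) here = contradiction k<z (irrefl refl)
  above-trans (node l<k _ _ _) (right k<z p) (left _ q) = contradiction (all-above l<k q) (asym k<z)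
  above-trans (node _ _ _ br) (right k<z p) (right k<x q) = right k<x (above-trans br p q)

  <-≮-trans : ∀ {x y z} → x < y → ¬ (z < y) → x < z
  <-≮-trans {x} {y} {z} x<y z≮y with compare y z
  ... | tri< y<z _ _  = <-trans x<y y<z
  ... | tri≈ _ refl _ = x<y
  ... | tri> _ _ z<y  = contradiction z<y z≮y

  ≮-<-trans : ∀ {x y z} → ¬ (y < x) → y < z → x < z
  ≮-<-trans {x} {y} y≮x y<z with compare x y
  ... | tri< x<y _ _  = <-trans x<y y<z
  ... | tri≈ _ refl _ = y<z
  ... | tri> _ _ y<x  = contradiction y<x y≮x

  -- The keys whose search visits `y` form an interval around `y`, which therefore contains
  -- everything between `y` and `x`.
  above-convex< : ∀ {t y w x} → IsBST t → y < w → ¬ (x < w) → Above t y x → Above t y w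
  above-convex< b y<w x≮w here = here
  above-convex< (node l<k _ bl _) y<w x≮w (left x<k p) =
    left (≮-<-trans x≮w x<k) (above-convex< bl y<w x≮w p)
  above-convex< (node _ k<r _ br) y<w x≮w (right k<x p) =
    right (<-trans (all-above k<r p) y<w) (above-convex< br y<w x≮w p)

  above-convex> : ∀ {t y w x} → IsBST t → w < y → ¬ (w < x) → Above t y x → Above t y w
  above-convex> b w<y w≮x here = here
  above-convex> (node l<k _ bl _) w<y w≮x (left x<k p) =
    left (<-trans w<y (all-above l<k p)) (above-convex> bl w<y w≮x p)
  above-convex> (node _ k<r _ br) w<y w≮x (right k<x p) =
    right (<-≮-trans k<x w≮x) (above-convex> br w<y w≮x p)

  -- Greedy Future serving one query

  Path : Set a
  Path = List (K × ℕ × BinTree K)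

  OnPath : K → Path → Set a
  OnPath y = Any (λ e → y ≡ proj₁ e)

  AllPath : ∀ {p} → (K → Set p) → BinTree K → Path → Set (a ⊔ p)
  AllPath P R []                = Allᵗ P U R
  AllPath P R ((v , _ , R′) ∷ vs) = Allᵗ P U R × P v × AllPath P R′ vs

  SortedPath : BinTree K → Path → Set (a ⊔ ℓ)
  SortedPath R []                  = IsBST R
  SortedPath R ((v , _ , R′) ∷ vs) =
    IsBST R × Allᵗ (_< v) U R × AllPath (v <_) R′ vs × SortedPath R′ vs

  -- The comparisons select the hanging subtree into whose gap `u` falls.
  HangAbove : BinTree K → Path → K → K → Set (a ⊔ ℓ)
  HangAbove R []                  y u = Above R y u
  HangAbove R ((v , _ , R′) ∷ vs) y u = (u < v × Above R y u) ⊎ (v < u × HangAbove R′ vs y u)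

  mapAllPath : ∀ {p q} {P : K → Set p} {Q : K → Set q} → (∀ {k} → P k → Q k) →
               ∀ {R} vs → AllPath P R vs → AllPath Q R vs
  mapAllPath f []       p             = mapₙ f p
  mapAllPath f (_ ∷ vs) (p , q , ps) = mapₙ f p , f q , mapAllPath f vs ps

  allPath-on : ∀ {p} {P : K → Set p} {R y} vs → AllPath P R vs → OnPath y vs → P y
  allPath-on (_ ∷ vs) (_ , q , _)  (here refl) = q
  allPath-on (_ ∷ vs) (_ , _ , ps) (there o)   = allPath-on vs ps o

  module _ {p} {P : K → Set p} where

    allPath-snoc⁺ : ∀ {R} vs {k δ r} → AllPath P R vs → P k → Allᵗ P U r →
                    AllPath P R (vs ++ (k , δ , r) ∷ [])
    allPath-snoc⁺ []       p            pk pr = p , pk , pr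
    allPath-snoc⁺ (_ ∷ vs) (p , q , ps) pk pr = p , q , allPath-snoc⁺ vs ps pk pr

    allPath-snoc⁻ : ∀ {R} vs {k δ r} → AllPath P R (vs ++ (k , δ , r) ∷ []) →
                    AllPath P R vs × P k × Allᵗ P U r
    allPath-snoc⁻ []       (p , pk , pr) = p , pk , pr
    allPath-snoc⁻ (_ ∷ vs) (p , q , ps) with allPath-snoc⁻ vs ps
    ... | ps′ , pk , pr = (p , q , ps′) , pk , pr

    searchPath-all⁺ : ∀ x δ t → Allᵗ P U t → let R , vs = searchPath x δ t in AllPath P R vs
    searchPath-all⁺ x δ (leaf _) p = p
    searchPath-all⁺ x δ (node l k r) (node pl pk pr) with compare x k
    ... | tri≈ _ _ _ = pl , pk , pr
    ... | tri< _ _ _ = allPath-snoc⁺ _ (searchPath-all⁺ x (suc δ) l pl) pk pr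
    ... | tri> _ _ _ = pl , pk , searchPath-all⁺ x (suc δ) r pr

    searchPath-all⁻ : ∀ x δ t → (let R , vs = searchPath x δ t in AllPath P R vs) → Allᵗ P U t
    searchPath-all⁻ x δ (leaf _) p = p
    searchPath-all⁻ x δ (node l k r) p with compare x k
    ... | tri≈ _ _ _ = let pl , pk , pr = p in node pl pk pr
    ... | tri< _ _ _ = let pl , pk , pr = allPath-snoc⁻ (proj₂ (searchPath x (suc δ) l)) p
                       in node (searchPath-all⁻ x (suc δ) l pl) pk pr
    ... | tri> _ _ _ = let pl , pk , pr = p in node pl pk (searchPath-all⁻ x (suc δ) r pr)

    insertLeftmost-all⁺ : ∀ {R v q} tr → Allᵗ P U R → P v → Allᵗ P U (reattach tr) →
                          Allᵗ P U (reattach (insertLeftmost R v q tr))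
    insertLeftmost-all⁺ (leaf R′) pR pv p = node pR pv p
    insertLeftmost-all⁺ {q = q} (node l (w , q′) r) pR pv p with q′ ≺? q | p
    ... | yes _ | node pl pw pr = node (insertLeftmost-all⁺ l pR pv pl) pw pr
    ... | no  _ | _             = node pR pv p

    insertLeftmost-all⁻ : ∀ {R v q} tr → Allᵗ P U (reattach (insertLeftmost R v q tr)) →
                          Allᵗ P U R × P v × Allᵗ P U (reattach tr)
    insertLeftmost-all⁻ (leaf R′) (node pR pv p) = pR , pv , p
    insertLeftmost-all⁻ {q = q} (node l (w , q′) r) p with q′ ≺? q | p
    ... | yes _ | node pl pw pr = let pR , pv , pl′ = insertLeftmost-all⁻ l pl in pR , pv , node pl′ pw pr
    ... | no  _ | node pR pv p′ = pR , pv , p′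

    treap-all⁺ : ∀ F lo R vs → AllPath P R vs → Allᵗ P U (reattach (treap F lo R vs))
    treap-all⁺ F lo R []                  p            = p
    treap-all⁺ F lo R ((v , _ , R′) ∷ vs) (p , q , ps) =
      insertLeftmost-all⁺ (treap F [ v ] R′ vs) p q (treap-all⁺ F [ v ] R′ vs ps)

    treap-all⁻ : ∀ F lo R vs → Allᵗ P U (reattach (treap F lo R vs)) → AllPath P R vs
    treap-all⁻ F lo R []                  p = p
    treap-all⁻ F lo R ((v , _ , R′) ∷ vs) p =
      let pR , pv , p′ = insertLeftmost-all⁻ (treap F [ v ] R′ vs) p
      in pR , pv , treap-all⁻ F [ v ] R′ vs p′

    serve-all⁺ : ∀ x F t → Allᵗ P U t → Allᵗ P U (serve x F t)
    serve-all⁺ x F t p = treap-all⁺ F ⊥± _ _ (searchPath-all⁺ x 0 t p)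

    serve-all⁻ : ∀ x F t → Allᵗ P U (serve x F t) → Allᵗ P U t
    serve-all⁻ x F t p = searchPath-all⁻ x 0 t (treap-all⁻ F ⊥± _ (proj₂ (searchPath x 0 t)) p)

  sorted-snoc : ∀ {R} vs {k δ r} → SortedPath R vs → AllPath (_< k) R vs → Allᵗ (k <_) U r → IsBST r →
                SortedPath R (vs ++ (k , δ , r) ∷ [])
  sorted-snoc []                 bR               R<k           k<r br = bR , R<k , k<r , br
  sorted-snoc ((v , _ , R′) ∷ vs) (bR , lt , gt , s) (R<k , v<k , vs<k) k<r br =
    bR , lt , allPath-snoc⁺ vs gt v<k (mapₙ (<-trans v<k) k<r) , sorted-snoc vs s vs<k k<r br

  searchPath-sorted : ∀ x δ t → IsBST t → let R , vs = searchPath x δ t in SortedPath R vs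
  searchPath-sorted x δ (leaf _) b = b
  searchPath-sorted x δ (node l k r) (node l<k k<r bl br) with compare x k
  ... | tri≈ _ _ _ = bl , l<k , k<r , br
  ... | tri< _ _ _ = sorted-snoc _ (searchPath-sorted x (suc δ) l bl) (searchPath-all⁺ x (suc δ) l l<k) k<r br
  ... | tri> _ _ _ = bl , l<k , searchPath-all⁺ x (suc δ) r k<r , searchPath-sorted x (suc δ) r br

  hang-snocˡ : ∀ {R} vs {k δ r y u} → AllPath (_< k) R vs → HangAbove R (vs ++ (k , δ , r) ∷ []) y u →
               (u < k × HangAbove R vs y u) ⊎ (k < u × Above r y u)
  hang-snocˡ []       _              h = h
  hang-snocˡ (_ ∷ vs) (_ , v<k , _)  (inj₁ (u<v , h)) = inj₁ (<-trans u<v v<k , inj₁ (u<v , h))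
  hang-snocˡ (_ ∷ vs) (_ , _ , vs<k) (inj₂ (v<u , h)) with hang-snocˡ vs vs<k h
  ... | inj₁ (u<k , h′) = inj₁ (u<k , inj₂ (v<u , h′))
  ... | inj₂ kr         = inj₂ kr

  hang⇒above : ∀ x δ t {y u} → IsBST t → (let R , vs = searchPath x δ t in HangAbove R vs y u) → Above t y u
  hang⇒above x δ (leaf _) b h = h
  hang⇒above x δ (node l k r) (node l<k k<r bl br) h with compare x k | h
  ... | tri≈ _ _ _ | inj₁ (u<k , p) = left u<k p
  ... | tri≈ _ _ _ | inj₂ (k<u , p) = right k<u p
  ... | tri< _ _ _ | h′ with hang-snocˡ _ (searchPath-all⁺ x (suc δ) l l<k) h′
  ...   | inj₁ (u<k , p) = left u<k (hang⇒above x (suc δ) l bl p)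
  ...   | inj₂ (k<u , p) = right k<u p
  hang⇒above x δ (node l k r) (node l<k k<r bl br) h | tri> _ _ _ | inj₁ (u<k , p) = left u<k p
  hang⇒above x δ (node l k r) (node l<k k<r bl br) h | tri> _ _ _ | inj₂ (k<u , p) =
    right k<u (hang⇒above x (suc δ) r br p)

  on⇒above : ∀ x δ t {y} → OnPath y (proj₂ (searchPath x δ t)) → Above t y x
  on⇒above x δ (node l k r) o with compare x k | o
  ... | tri≈ _ _ _ | here refl = here
  ... | tri< x<k _ _ | o′ with Any.++⁻ (proj₂ (searchPath x (suc δ) l)) o′
  ...   | inj₁ p           = left x<k (on⇒above x (suc δ) l p)
  ...   | inj₂ (here refl) = here
  on⇒above x δ (node l k r) o | tri> _ _ k<x | here refl = here
  on⇒above x δ (node l k r) o | tri> _ _ k<x | there p   = right k<x (on⇒above x (suc δ) r p)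

  above⇒on : ∀ x δ t {y} → Above t y x → OnPath y (proj₂ (searchPath x δ t))
  above⇒on x δ (node l k r) p with compare x k | p
  ... | tri≈ _ _ _     | here        = here refl
  ... | tri≈ ¬lt _ _   | left lt _   = contradiction lt ¬lt
  ... | tri≈ _ _ ¬gt   | right gt _  = contradiction gt ¬gt
  ... | tri< _ _ _     | here        = Any.++⁺ʳ (proj₂ (searchPath x (suc δ) l)) (here refl)
  ... | tri< _ _ _     | left _ q    = Any.++⁺ˡ (above⇒on x (suc δ) l q)
  ... | tri< _ _ ¬gt   | right gt _  = contradiction gt ¬gt
  ... | tri> _ _ _     | here        = here refl
  ... | tri> ¬lt _ _   | left lt _   = contradiction lt ¬lt
  ... | tri> _ _ _     | right _ q   = there (above⇒on x (suc δ) r q)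

  insertLeftmost-bst : ∀ {R v q} tr → IsBST R → Allᵗ (_< v) U R → Allᵗ (v <_) U (reattach tr) →
                       IsBST (reattach tr) → IsBST (reattach (insertLeftmost R v q tr))
  insertLeftmost-bst (leaf R′) bR R<v v<t bt = node R<v v<t bR bt
  insertLeftmost-bst {q = q} (node l (w , q′) r) bR R<v v<t bt with q′ ≺? q | v<t | bt
  ... | yes _ | node v<l v<w v<r | node l<w w<r bl br =
    node (insertLeftmost-all⁺ l (mapₙ (λ z<v → <-trans z<v v<w) R<v) v<w l<w) w<r
         (insertLeftmost-bst l bR R<v v<l bl) br
  ... | no _ | _ | _ = node R<v v<t bR bt

  treap-bst : ∀ F lo R vs → SortedPath R vs → IsBST (reattach (treap F lo R vs))
  treap-bst F lo R []                  b                 = b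
  treap-bst F lo R ((v , _ , R′) ∷ vs) (bR , lt , gt , s) =
    insertLeftmost-bst (treap F [ v ] R′ vs) bR lt (treap-all⁺ F [ v ] R′ vs gt) (treap-bst F [ v ] R′ vs s)

  serve-bst : ∀ x F t → IsBST t → IsBST (serve x F t)
  serve-bst x F t b = treap-bst F ⊥± _ (proj₂ (searchPath x 0 t)) (searchPath-sorted x 0 t b)

  serve-∈⁺ : ∀ x F t {k} → IsBST t → k ∈ᵗ t → k ∈ᵗ serve x F t
  serve-∈⁺ x F t b = all-above (serve-all⁻ x F t (all-∈ (serve-bst x F t b)))

  serve-∈⁻ : ∀ x F t {k} → IsBST t → k ∈ᵗ serve x F t → k ∈ᵗ t
  serve-∈⁻ x F t b = all-above (serve-all⁺ x F t (all-∈ b))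

  -- Treap keys and hanging subtrees

  InTreap : Treap → K → Set a
  InTreap (leaf _)           k = Lift a ⊥
  InTreap (node l (w , _) r) k = InTreap l k ⊎ k ≡ w ⊎ InTreap r k

  allTreap : ∀ {p} {P : K → Set p} tr {k} → Allᵗ P U (reattach tr) → InTreap tr k → P k
  allTreap (node l _ r) (node p _ _) (inj₁ i)           = allTreap l p i
  allTreap (node l _ r) (node _ p _) (inj₂ (inj₁ refl)) = p
  allTreap (node l _ r) (node _ _ p) (inj₂ (inj₂ i))    = allTreap r p i

  insertLeftmost-above : ∀ {R v q} tr {y u} → Allᵗ (v <_) U (reattach tr) →
                         Above (reattach (insertLeftmost R v q tr)) y u →
                         (y ≡ v ⊎ InTreap tr y) ⊎ (u < v × Above R y u) ⊎ (v < u × Above (reattach tr) y u)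
  insertLeftmost-above (leaf R′) v<t here           = inj₁ (inj₁ refl)
  insertLeftmost-above (leaf R′) v<t (left u<v p)   = inj₂ (inj₁ (u<v , p))
  insertLeftmost-above (leaf R′) v<t (right v<u p)  = inj₂ (inj₂ (v<u , p))
  insertLeftmost-above {q = q} (node l (w , q′) r) v<t p with q′ ≺? q | v<t | p
  ... | no _  | _ | here        = inj₁ (inj₁ refl)
  ... | no _  | _ | left u<v h  = inj₂ (inj₁ (u<v , h))
  ... | no _  | _ | right v<u h = inj₂ (inj₂ (v<u , h))
  ... | yes _ | _ | here        = inj₁ (inj₂ (inj₂ (inj₁ refl)))
  ... | yes _ | node _ v<w _ | right w<u h = inj₂ (inj₂ (<-trans v<w w<u , right w<u h))
  ... | yes _ | node v<l _ _ | left u<w h with insertLeftmost-above l v<l h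
  ...   | inj₁ (inj₁ e)          = inj₁ (inj₁ e)
  ...   | inj₁ (inj₂ i)          = inj₁ (inj₂ (inj₁ i))
  ...   | inj₂ (inj₁ h′)         = inj₂ (inj₁ h′)
  ...   | inj₂ (inj₂ (v<u , h′)) = inj₂ (inj₂ (v<u , left u<w h′))

  insertLeftmost-in⁺ : ∀ {R v q} tr {y} → y ≡ v ⊎ InTreap tr y → InTreap (insertLeftmost R v q tr) y
  insertLeftmost-in⁺ (leaf _) (inj₁ e) = inj₂ (inj₁ e)
  insertLeftmost-in⁺ {q = q} (node l (w , q′) r) i with q′ ≺? q | i
  ... | no _  | inj₁ e                = inj₂ (inj₁ e)
  ... | no _  | inj₂ j                = inj₂ (inj₂ j)
  ... | yes _ | inj₁ e                = inj₁ (insertLeftmost-in⁺ l (inj₁ e))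
  ... | yes _ | inj₂ (inj₁ j)         = inj₁ (insertLeftmost-in⁺ l (inj₂ j))
  ... | yes _ | inj₂ (inj₂ j)         = inj₂ j

  insertLeftmost-in⁻ : ∀ {R v q} tr {y} → InTreap (insertLeftmost R v q tr) y → y ≡ v ⊎ InTreap tr y
  insertLeftmost-in⁻ (leaf _) (inj₂ (inj₁ e)) = inj₁ e
  insertLeftmost-in⁻ {q = q} (node l (w , q′) r) i with q′ ≺? q | i
  ... | no _  | inj₂ j       = j
  ... | yes _ | inj₂ j       = inj₂ (inj₂ j)
  ... | yes _ | inj₁ j with insertLeftmost-in⁻ l j
  ...   | inj₁ e  = inj₁ e
  ...   | inj₂ j′ = inj₂ (inj₁ j′)

  treap-in⁺ : ∀ F lo R vs {y} → OnPath y vs → InTreap (treap F lo R vs) y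
  treap-in⁺ F lo R ((v , _ , R′) ∷ vs) (here e)  = insertLeftmost-in⁺ (treap F [ v ] R′ vs) (inj₁ e)
  treap-in⁺ F lo R ((v , _ , R′) ∷ vs) (there o) =
    insertLeftmost-in⁺ (treap F [ v ] R′ vs) (inj₂ (treap-in⁺ F [ v ] R′ vs o))

  treap-in⁻ : ∀ F lo R vs {y} → InTreap (treap F lo R vs) y → OnPath y vs
  treap-in⁻ F lo R ((v , _ , R′) ∷ vs) i with insertLeftmost-in⁻ (treap F [ v ] R′ vs) i
  ... | inj₁ e = here e
  ... | inj₂ j = there (treap-in⁻ F [ v ] R′ vs j)

  treap-above : ∀ F lo R vs {y u} → SortedPath R vs → Above (reattach (treap F lo R vs)) y u →
                OnPath y vs ⊎ HangAbove R vs y u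
  treap-above F lo R []                  s p = inj₂ p
  treap-above F lo R ((v , _ , R′) ∷ vs) (_ , _ , gt , s) p
    with insertLeftmost-above (treap F [ v ] R′ vs) (treap-all⁺ F [ v ] R′ vs gt) p
  ... | inj₁ (inj₁ e)         = inj₁ (here e)
  ... | inj₁ (inj₂ i)         = inj₁ (there (treap-in⁻ F [ v ] R′ vs i))
  ... | inj₂ (inj₁ h)         = inj₂ (inj₁ h)
  ... | inj₂ (inj₂ (v<u , h)) with treap-above F [ v ] R′ vs s h
  ...   | inj₁ o  = inj₁ (there o)
  ...   | inj₂ h′ = inj₂ (inj₂ (v<u , h′))

  -- Hanging subtrees are reattached unchanged, so an ancestor of `u` in the new tree either comes
  -- from the rearranged path or was an ancestor before. With convexity, this is what makes the
  -- invariants persist.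
  serve-above : ∀ x F t {y u} → IsBST t → Above (serve x F t) y u → Above t y x ⊎ Above t y u
  serve-above x F t b p with treap-above F ⊥± _ (proj₂ (searchPath x 0 t)) (searchPath-sorted x 0 t b) p
  ... | inj₁ o = inj₁ (on⇒above x 0 t o)
  ... | inj₂ h = inj₂ (hang⇒above x 0 t b h)

  -- Heap order of the treap

  private
    τ≤ : Time → K × Priority → Set
    τ≤ τ (_ , τ′ , _) = τ ≤⁺ τ′

  -- Times are compared weakly; the contradictions will come from strict inequalities between times.
  Heap : Treap → Set a
  Heap (leaf _)           = Lift a ⊤
  Heap (node l (_ , τ , _) r) = Allᵗ (τ≤ τ) U l × Allᵗ (τ≤ τ) U r × Heap l × Heap r

  insertLeftmost-allT : ∀ {p} {P : K × Priority → Set p} {R v q} tr → P (v , q) → Allᵗ P U tr →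
                        Allᵗ P U (insertLeftmost R v q tr)
  insertLeftmost-allT (leaf _) pv p = node (leaf _) pv (leaf _)
  insertLeftmost-allT {q = q} (node l (w , q′) r) pv p with q′ ≺? q | p
  ... | yes _ | node pl pw pr = node (insertLeftmost-allT l pv pl) pw pr
  ... | no  _ | _             = node (leaf _) pv p

  mapAllT : ∀ {p q} {P : K × Priority → Set p} {Q : K × Priority → Set q} {tr : Treap} →
            (∀ {k} → P k → Q k) → Allᵗ P U tr → Allᵗ Q U tr
  mapAllT f (leaf _)     = leaf _
  mapAllT f (node l p r) = node (mapAllT f l) (f p) (mapAllT f r)

  insertLeftmost-heap : ∀ {R v q} tr → Heap tr → Heap (insertLeftmost R v q tr)
  insertLeftmost-heap (leaf _) h = leaf _ , leaf _ , _ , _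
  insertLeftmost-heap {q = q} (node l (w , q′) r) h@(hl , hr , l′ , r′) with q′ ≺? q
  ... | yes lt = insertLeftmost-allT l (≺⇒≤⁺ lt) hl , hr , insertLeftmost-heap l l′ , r′
  ... | no ¬lt = leaf _ , node (mapAllT (SupN.≤⁺-trans ℕ._≤_ ℕ.≤-trans le) hl) le
                               (mapAllT (SupN.≤⁺-trans ℕ._≤_ ℕ.≤-trans le) hr) , _ , h
    where le = ⊀⇒≥⁺ ¬lt

  treap-heap : ∀ F lo R vs → Heap (treap F lo R vs)
  treap-heap F lo R []                  = _
  treap-heap F lo R ((v , _ , R′) ∷ vs) = insertLeftmost-heap (treap F [ v ] R′ vs) (treap-heap F [ v ] R′ vs)

  lookupT : ∀ {p} {P : K × Priority → Set p} (tr : Treap) {k} → Allᵗ P U tr → InTreap tr k → ∃ λ q → P (k , q)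
  lookupT (node l _ r) (node p _ _) (inj₁ i)           = lookupT l p i
  lookupT (node l _ r) (node _ p _) (inj₂ (inj₁ refl)) = _ , p
  lookupT (node l _ r) (node _ _ p) (inj₂ (inj₂ i))    = lookupT r p i

  bothT : ∀ {p q} {P : K × Priority → Set p} {Q : K × Priority → Set q} {tr : Treap} →
          Allᵗ P U tr → Allᵗ Q U tr → Allᵗ (λ e → P e × Q e) U tr
  bothT (leaf _)     (leaf _)       = leaf _
  bothT (node l p r) (node l′ p′ r′) = node (bothT l l′) (p , p′) (bothT r r′)

  -- `reattach` erases priorities, so `P` returns what is known about the times of both keys.
  -- Membership in the treap keeps out keys of hanging subtrees, which have no priority.
  heap-above : ∀ {p} {P : K → Time → Set p} tr {z y} → Heap tr → IsBST (reattach tr) →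
               Allᵗ (λ (k , τ , _) → P k τ) U tr →
               InTreap tr z → InTreap tr y → Above (reattach tr) z y →
               z ≡ y ⊎ ∃₂ λ τ τ′ → P z τ × P y τ′ × τ ≤⁺ τ′
  heap-above (node l (w , q) r) h b (node al pw ar) iz (inj₂ (inj₁ refl)) here = inj₁ refl
  heap-above (node l (w , q) r) (hl , _) b (node al pw ar) iz (inj₁ iy) here
    with lookupT l (bothT al hl) iy
  ... | _ , py , le = inj₂ (_ , _ , pw , py , le)
  heap-above (node l (w , q) r) (_ , hr , _) b (node al pw ar) iz (inj₂ (inj₂ iy)) here
    with lookupT r (bothT ar hr) iy
  ... | _ , py , le = inj₂ (_ , _ , pw , py , le)
  heap-above {P = P} (node l (w , q) r) {z} {y} (_ , _ , l′ , _) (node l<w w<r bl br) (node al pw ar)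
    iz iy (left y<w p) =
    heap-above {P = P} l l′ bl al (onLeft iz (all-above l<w p)) (onLeft iy y<w) p
    where
    onLeft : ∀ {k} → InTreap (node l (w , q) r) k → k < w → InTreap l k
    onLeft (inj₁ i)           k<w = i
    onLeft (inj₂ (inj₁ refl)) k<w = contradiction k<w (irrefl refl)
    onLeft (inj₂ (inj₂ i))    k<w = contradiction (allTreap r w<r i) (asym k<w)
  heap-above {P = P} (node l (w , q) r) {z} {y} (_ , _ , _ , r′) (node l<w w<r bl br) (node al pw ar)
    iz iy (right w<y p) =
    heap-above {P = P} r r′ br ar (onRight iz (all-above w<r p)) (onRight iy w<y) p
    where
    onRight : ∀ {k} → InTreap (node l (w , q) r) k → w < k → InTreap r k
    onRight (inj₁ i)           w<k = contradiction (allTreap l l<w i) (asym w<k)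
    onRight (inj₂ (inj₁ refl)) w<k = contradiction w<k (irrefl refl)
    onRight (inj₂ (inj₂ i))    w<k = i

  -- The intervals that define τ

  -- The interval between the two path neighbours of `k`, described without naming them: `c` lies on
  -- the same side as `k` of every other path key. This form does not depend on the position of `k`
  -- in the list.
  Gap : K ± → Path → K → K → Set (a ⊔ ℓ)
  Gap lo vs k c = lo <± [ c ] × (∀ w → OnPath w vs → (w < k → w < c) × (k < w → c < w))

  -- Both inclusions matter: to compare two keys, one interval has to be large enough and the other
  -- small enough.
  Label : List K → K ± → Path → K → Time → Set (a ⊔ ℓ)
  Label F lo vs k τ = ∃₂ λ l h → τ ≡ nextHit l h F ×
                      (∀ c → In l h c → Gap lo vs k c) × (∀ c → Gap lo vs k c → In l h c)

  nextKey-in : ∀ {R v} vs {w c} → AllPath (v <_) R vs → SortedPath R vs →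
               [ c ] <± nextKey vs → OnPath w vs → c < w
  nextKey-in (_ ∷ vs) _ s c<n (here refl) = [<]-injective c<n
  nextKey-in (_ ∷ vs) _ (_ , _ , gt , _) c<n (there o) = <-trans ([<]-injective c<n) (allPath-on vs gt o)

  treap-keys : ∀ {p} {P : K → Set p} F lo R vs → AllPath P R vs → Allᵗ (P ∘ proj₁) U (treap F lo R vs)
  treap-keys F lo R []                  _           = leaf _
  treap-keys F lo R ((v , _ , R′) ∷ vs) (_ , q , ps) =
    insertLeftmost-allT (treap F [ v ] R′ vs) q (treap-keys F [ v ] R′ vs ps)

  treap-labels : ∀ F lo R vs → AllPath (λ k → lo <± [ k ]) R vs → SortedPath R vs →
                 Allᵗ (λ (k , τ , _) → Label F lo vs k τ) U (treap F lo R vs)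
  treap-labels F lo R []                  _              s                  = leaf _
  treap-labels F lo R ((v , δ , R′) ∷ vs) (_ , lo<v , lo<vs) (_ , lt , gt , s) =
    insertLeftmost-allT (treap F [ v ] R′ vs) (lo , nextKey vs , refl , to , from vs gt)
      (mapAllT (λ {e} → widen {e}) (bothT (treap-keys {P = v <_} F [ v ] R′ vs gt)
                                          (treap-labels F [ v ] R′ vs (mapAllPath [<] vs gt) s)))
    where
    to : ∀ c → In lo (nextKey vs) c → Gap lo ((v , δ , R′) ∷ vs) v c
    to c (lo<c , c<n) = lo<c , λ where
      w (here refl) → (λ w<w → contradiction w<w (irrefl refl)) , (λ w<w → contradiction w<w (irrefl refl))
      w (there o)   → (λ w<v → contradiction (allPath-on vs gt o) (asym w<v)) , (λ _ → nextKey-in vs gt s c<n o)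

    from : ∀ us → AllPath (v <_) R′ us → ∀ c → Gap lo ((v , δ , R′) ∷ us) v c → In lo (nextKey us) c
    from []             _             c (lo<c , _) = lo<c , [ c ]<⊤±
    from ((w , _) ∷ us) (_ , v<w , _) c (lo<c , f) = lo<c , [<] (proj₂ (f w (there (here refl))) v<w)

    -- The lower end `[ v ]` for the shorter path turns into the constraint from the path key `v`,
    -- and implies the one from `lo`.
    widen : ∀ {e : K × Priority} → v < proj₁ e × Label F [ v ] vs (proj₁ e) (proj₁ (proj₂ e)) →
            Label F lo ((v , δ , R′) ∷ vs) (proj₁ e) (proj₁ (proj₂ e))
    widen {k , _} (v<k , l , h , eq , f , g) = l , h , eq , to′ , from′
      where
      to′ : ∀ c → In l h c → Gap lo ((v , δ , R′) ∷ vs) k c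
      to′ c i = let v<c , i′ = f c i in <±-trans <-trans lo<v v<c , λ where
        w (here refl) → (λ _ → [<]-injective v<c) , (λ k<v → contradiction k<v (asym v<k))
        w (there o)   → i′ w o
      from′ : ∀ c → Gap lo ((v , δ , R′) ∷ vs) k c → In l h c
      from′ c (_ , i) = g c ([<] (proj₁ (i v (here refl)) v<k) , λ w o → i w (there o))

  -- The interval in the definition of τ(y), for y on the search path to x.
  Int : BinTree K → K → K → K → Set (a ⊔ ℓ)
  Int t x y c = ∀ w → Above t w x → (w < y → w < c) × (y < w → c < w)

  -- With `z` above `y` the heap order gives τ(z) ≤ τ(y), whereas the future hits the interval of
  -- `y` strictly earlier.
  serve-heap : ∀ x F t {y z} → IsBST t → Above t y x → Above t z x → z ≢ y →
               Before (Int t x y) (Int t x z) F → ¬ Above (serve x F t) z y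
  serve-heap x F t {y} {z} b ay az z≢y bf azy = conclude
      (heap-above {P = Label F ⊥± vs} tr (treap-heap F ⊥± R vs) (serve-bst x F t b)
        (treap-labels F ⊥± R vs (searchPath-all⁺ x 0 t (mapₙ (λ {k} _ → ⊥±<[ k ]) (all-∈ b)))
                               (searchPath-sorted x 0 t b))
        (treap-in⁺ F ⊥± R vs (above⇒on x 0 t az)) (treap-in⁺ F ⊥± R vs (above⇒on x 0 t ay)) azy)
    where
    R  = proj₁ (searchPath x 0 t)
    vs = proj₂ (searchPath x 0 t)
    tr = treap F ⊥± R vs
    conclude : z ≡ y ⊎ (∃₂ λ τ τ′ → Label F ⊥± vs z τ × Label F ⊥± vs y τ′ × τ ≤⁺ τ′) → ⊥
    conclude (inj₁ e) = z≢y e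
    conclude (inj₂ (_ , _ , (_ , _ , refl , fz , _) , (_ , _ , refl , _ , gy) , le)) =
      ≤⁺⇒≯⁺ le (nextHit-< (Before-map
        (λ {c} i → gy c (⊥±<[ c ] , λ w o → i w (on⇒above x 0 t o)))
        (λ {c} i w aw → proj₂ (fz c i) w (above⇒on x 0 t aw)) bf))

  -- Consecutive queries

  run : List K → List K → BinTree K → BinTree K
  run []       F t = t
  run (x ∷ xs) F t = run xs F (serve x (xs ++ F) t)

  gf-run : ∀ xs F t → gf t (xs ++ F) (length xs) ≡ run xs F t
  gf-run []       F t = refl
  gf-run (x ∷ xs) F t = gf-run xs F _

  run-++ : ∀ xs ys F t → run (xs ++ ys) F t ≡ run ys F (run xs (ys ++ F) t)
  run-++ []       ys F t = refl
  run-++ (x ∷ xs) ys F t rewrite ++-assoc xs ys F = run-++ xs ys F _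

  run-bst : ∀ xs F t → IsBST t → IsBST (run xs F t)
  run-bst []       F t b = b
  run-bst (x ∷ xs) F t b = run-bst xs F _ (serve-bst x _ t b)

  run-∈ : ∀ xs F t {k} → IsBST t → k ∈ᵗ t → k ∈ᵗ run xs F t
  run-∈ []       F t b i = i
  run-∈ (x ∷ xs) F t b i = run-∈ xs F _ (serve-bst x _ t b) (serve-∈⁺ x _ t b i)

  run-∈⁻ : ∀ xs F t {k} → IsBST t → k ∈ᵗ run xs F t → k ∈ᵗ t
  run-∈⁻ []       F t b i = i
  run-∈⁻ (x ∷ xs) F t b i = serve-∈⁻ x _ t b (run-∈⁻ xs F _ (serve-bst x _ t b) i)

  serve-above-self : ∀ x F t {y} → IsBST t → Above (serve x F t) y x → Above t y x
  serve-above-self x F t b p = Sum.reduce (serve-above x F t b p)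

  -- Nodes that stay off the paths to the ends of their intervals

  Bound : K ± → K ± → K → Set a
  Bound lo hi w = lo ≡ [ w ] ⊎ hi ≡ [ w ]

  Protected : BinTree K → K ± → K → K ± → Set (a ⊔ ℓ)
  Protected t lo v hi = ∀ w → Bound lo hi w → ¬ Above t v w

  Placed : BinTree K → K ± → K ± → BinTree K → Set (a ⊔ ℓ)
  Placed (leaf _)     lo hi t = Lift _ ⊤
  Placed (node l v r) lo hi t = Protected t lo v hi × Placed l lo [ v ] t × Placed r [ v ] hi t

  Fits : K ± → K ± → BinTree K → Set (a ⊔ ℓ)
  Fits lo hi (leaf _)     = Lift _ ⊤
  Fits lo hi (node l v r) = In lo hi v × Fits lo [ v ] l × Fits [ v ] hi r

  fits : ∀ {lo hi T} → IsBST T → Allᵗ (In lo hi) U T → Fits lo hi T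
  fits leaf _ = _
  fits (node l<v v<r bl br) (node al i ar) =
    i , fits bl (zipAll (λ { k<v (lo<k , _) → lo<k , [<] k<v }) l<v al)
      , fits br (zipAll (λ { v<k (_ , k<hi) → [<] v<k , k<hi }) v<r ar)

  in-widenˡ : ∀ {lo hi v c} → [ v ] <± hi → In lo [ v ] c → In lo hi c
  in-widenˡ v<hi (lo<c , c<v) = lo<c , <±-trans <-trans c<v v<hi

  in-widenʳ : ∀ {lo hi v c} → lo <± [ v ] → In [ v ] hi c → In lo hi c
  in-widenʳ lo<v (v<c , c<hi) = <±-trans <-trans lo<v v<c , c<hi

  fits-all : ∀ {lo hi} T → Fits lo hi T → Allᵗ (In lo hi) U T
  fits-all (leaf _)     _              = leaf _
  fits-all (node l v r) (i , fl , fr) =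
    node (mapₙ (in-widenˡ (proj₂ i)) (fits-all l fl)) i (mapₙ (in-widenʳ (proj₁ i)) (fits-all r fr))

  -- An end separates `x` from `v` or equals `x`. If `v` were on the search path to `x`, it would by
  -- convexity already be above that end.
  protected-serve : ∀ {lo hi v t} x F → IsBST t → In lo hi v → ¬ In lo hi x →
                    Protected t lo v hi → Protected (serve x F t) lo v hi
  protected-serve {lo} {hi} {v} {t} x F b (lo<v , v<hi) x∉ pr w bw p with serve-above x F t b p
  ... | inj₂ q = pr w bw q
  ... | inj₁ q with compare x v
  ...   | tri≈ _ refl _ = x∉ (lo<v , v<hi)
  ...   | tri< x<v _ _ = below lo<v x∉ pr
    where
    below : ∀ {lo} → lo <± [ v ] → ¬ In lo hi x → Protected t lo v hi → ⊥
    below ⊥±<[ _ ]             x∉ pr = x∉ (⊥±<[ x ] , <±-trans <-trans ([<] x<v) v<hi)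
    below AddExtrema.[ a<v ] x∉ pr = pr _ (inj₁ refl)
      (above-convex> b a<v (λ a<x → x∉ ([<] a<x , <±-trans <-trans ([<] x<v) v<hi)) q)
  ...   | tri> _ _ v<x = above v<hi x∉ pr
    where
    above : ∀ {hi} → [ v ] <± hi → ¬ In lo hi x → Protected t lo v hi → ⊥
    above [ _ ]<⊤±             x∉ pr = x∉ (<±-trans <-trans lo<v ([<] v<x) , [ x ]<⊤±)
    above AddExtrema.[ v<b ] x∉ pr = pr _ (inj₂ refl)
      (above-convex< b v<b (λ x<b → x∉ (<±-trans <-trans lo<v ([<] v<x) , [<] x<b)) q)

  placed-serve : ∀ T {lo hi t} x F → IsBST t → Fits lo hi T → ¬ In lo hi x →
                 Placed T lo hi t → Placed T lo hi (serve x F t)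
  placed-serve (leaf _)     x F b _ x∉ _ = _
  placed-serve (node l v r) x F b (i , fl , fr) x∉ (pr , pl , pr′) =
    protected-serve x F b i x∉ pr ,
    placed-serve l x F b fl (x∉ ∘ in-widenˡ (proj₂ i)) pl ,
    placed-serve r x F b fr (x∉ ∘ in-widenʳ (proj₁ i)) pr′

  placed-run : ∀ T {lo hi t} xs F → IsBST t → Fits lo hi T → All (¬_ ∘ In lo hi) xs →
               Placed T lo hi t → Placed T lo hi (run xs F t)
  placed-run T []       F b f All.[]       p = p
  placed-run T (x ∷ xs) F b f (x∉ All.∷ xs∉) p =
    placed-run T xs F (serve-bst x _ _ b) f xs∉ (placed-serve T x _ b f x∉ p)

  -- Keys without smaller or without larger ancestors

  NoLess NoMore : BinTree K → K → Set (a ⊔ ℓ)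
  NoLess t v = ∀ y → y < v → ¬ Above t y v
  NoMore t v = ∀ y → v < y → ¬ Above t y v

  -- A smaller key that gets above `v` comes from the path to some x ≥ v, and by convexity was above
  -- `v` before.
  noLess-run : ∀ {v t} xs F → IsBST t → All (λ x → ¬ (x < v)) xs → NoLess t v → NoLess (run xs F t) v
  noLess-run [] F b All.[] n = n
  noLess-run {v} {t} (x ∷ xs) F b (x≮v All.∷ xs≮v) n =
    noLess-run xs F (serve-bst x _ _ b) xs≮v λ y y<v p → n y y<v
      (Sum.[ above-convex< b y<v x≮v , id ] (serve-above x _ t b p))

  noMore-run : ∀ {v t} xs F → IsBST t → All (λ x → ¬ (v < x)) xs → NoMore t v → NoMore (run xs F t) v
  noMore-run [] F b All.[] n = n
  noMore-run {v} {t} (x ∷ xs) F b (v≮x All.∷ v≮xs) n =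
    noMore-run xs F (serve-bst x _ _ b) v≮xs λ y v<y p → n y v<y
      (Sum.[ above-convex> b v<y v≮x , id ] (serve-above x _ t b p))

  int-self : ∀ {t x y} → Int t x y y
  int-self w _ = id , id

  -- As `v` is on the path, the interval of a smaller path key lies entirely below `v`; the future
  -- asks `v` before anything there.
  noLess-serve : ∀ {v F t} → IsBST t → v ∈ᵗ t → Before (_≡ v) (_< v) F → NoLess (serve v F t) v
  noLess-serve {v} {F} {t} b v∈t bf y y<v p = serve-heap v F t b v∈t (serve-above-self v F t b p)
    (λ y≡v → irrefl y≡v y<v)
    (Before-map (λ { refl → int-self {t} {v} }) (λ i → proj₂ (i v v∈t) y<v) bf) p

  noMore-serve : ∀ {v F t} → IsBST t → v ∈ᵗ t → Before (_≡ v) (v <_) F → NoMore (serve v F t) v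
  noMore-serve {v} {F} {t} b v∈t bf y v<y p = serve-heap v F t b v∈t (serve-above-self v F t b p)
    (λ y≡v → irrefl (sym y≡v) v<y)
    (Before-map (λ { refl → int-self {t} {v} }) (λ i → proj₁ (i v v∈t) v<y) bf) p

  -- The next query becomes the root

  Rooted : BinTree K → K → Set a
  Rooted t w = ∃₂ λ l r → t ≡ node l w r

  serve-root : ∀ {w t} F → Rooted t w → serve w F t ≡ t
  serve-root {w} F (l , r , refl) with compare w w
  ... | tri< w<w _ _ = contradiction w<w (irrefl refl)
  ... | tri≈ _ _ _   = refl
  ... | tri> _ _ w<w = contradiction w<w (irrefl refl)

  rooted-above : ∀ {t w u} → Rooted t w → Above t w u
  rooted-above (_ , _ , refl) = here

  -- τ(w) is the very next time, and no other path key shares it, since the path key `w` is excluded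
  -- from all other intervals.
  next-root : ∀ {w x F t} → IsBST t → Above t w x → Rooted (serve x (w ∷ F) t) w
  next-root {w} {x} {F} {t} b p = go _ refl
    where
    go : ∀ t′ → serve x (w ∷ F) t ≡ t′ → Rooted t′ w
    -- With the empty predicate, `serve-all⁻` says that only an empty tree is served into a leaf,
    -- but `w` is a node of `t`.
    go (leaf _) eq = ⊥-elim (all-above
      (serve-all⁻ {P = λ _ → ⊥} x (w ∷ F) t (subst (Allᵗ _ U) (sym eq) (leaf _))) p)
    go (node l k r) eq = l , r , cong (λ k → node l k r) k≡w
      where
      k-above : ∀ u → Above (serve x (w ∷ F) t) k u
      k-above u = subst (λ t → Above t k u) (sym eq) here
      k≡w : k ≡ w
      k≡w with compare k w
      ... | tri≈ _ e _ = e
      ... | tri< k<w k≢w _ = contradiction (k-above w) (serve-heap x (w ∷ F) t b p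
              (serve-above-self x _ t b (k-above x)) k≢w
              (here int-self (λ i → irrefl refl (proj₂ (i w p) k<w))))
      ... | tri> _ k≢w w<k = contradiction (k-above w) (serve-heap x (w ∷ F) t b p
              (serve-above-self x _ t b (k-above x)) k≢w
              (here int-self (λ i → irrefl refl (proj₁ (i w p) w<k))))

  -- Either way, τ(a) is smaller than τ(v) for every v in (lo , hi): without a smaller
  -- key above a, the interval for τ(a) contains all keys less than a.
  LeftFirst RightFirst : BinTree K → K ± → K ± → List K → Set (a ⊔ ℓ)
  LeftFirst  t lo hi F = ∀ a → lo ≡ [ a ] → Before (λ c → c ≡ a ⊎ NoLess t a × c < a) (In lo hi) F
  RightFirst t lo hi F = ∀ b → hi ≡ [ b ] → Before (λ c → c ≡ b ⊎ NoMore t b × b < c) (In lo hi) F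

  Within : K ± → K ± → K → Set (a ⊔ ℓ)
  Within lo hi x = ¬ ([ x ] <± lo) × ¬ (hi <± [ x ])

  int⇒in : ∀ {t x v lo hi c} → In lo hi v → (∀ w → Bound lo hi w → Above t w x) → Int t x v c → In lo hi c
  int⇒in {t} {x} {v} {c = c} (lo<v , v<hi) ab i = lower lo<v (λ w → ab w ∘ inj₁) , upper v<hi (λ w → ab w ∘ inj₂)
    where
    lower : ∀ {lo} → lo <± [ v ] → (∀ w → lo ≡ [ w ] → Above t w x) → lo <± [ c ]
    lower ⊥±<[ _ ]             ab = ⊥±<[ c ]
    lower AddExtrema.[ a<v ] ab = [<] (proj₁ (i _ (ab _ refl)) a<v)
    upper : ∀ {hi} → [ v ] <± hi → (∀ w → hi ≡ [ w ] → Above t w x) → [ c ] <± hi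
    upper [ _ ]<⊤±             ab = [ c ]<⊤±
    upper AddExtrema.[ v<b ] ab = [<] (proj₂ (i _ (ab _ refl)) v<b)

  -- With the finite ends on the path to `x`, the interval of τ(v) shrinks into (lo , hi), and the
  -- future hits the interval of each finite end earlier.
  push : ∀ {t lo v hi} x F → IsBST t → In lo hi v → Within lo hi x →
         (∀ w → Bound lo hi w → Above t w x) →
         LeftFirst t lo hi F → RightFirst t lo hi F → Protected (serve x F t) lo v hi
  push {t} {lo} {v} {hi} x F b i wi ab lf rf w bw p =
    serve-heap x F t b (ab w bw) v-above (v≢w i bw) (before wi lf rf (int⇒in i ab) bw) p
    where
    -- If `v` is above the end `w` afterwards, it was on the path, or above `w`, which is itself on
    -- the path.
    v-above : Above t v x
    v-above = Sum.[ id , (λ q → above-trans b q (ab w bw)) ] (serve-above x F t b p)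
    v≢w : ∀ {lo hi w} → In lo hi v → Bound lo hi w → v ≢ w
    v≢w (lo<v , _) (inj₁ refl) refl = irrefl refl ([<]-injective lo<v)
    v≢w (_ , v<hi) (inj₂ refl) refl = irrefl refl ([<]-injective v<hi)
    int-low : ∀ {a c} → ¬ (x < a) → c ≡ a ⊎ NoLess t a × c < a → Int t x a c
    int-low x≮a (inj₁ refl)      = int-self {t} {x}
    int-low x≮a (inj₂ (n , c<a)) u au =
      -- `NoLess` concerns the path to `a`; convexity carries it over to the path to `x`, which is
      -- not below `a`.
      (λ u<a → contradiction (above-convex< b u<a x≮a au) (n u u<a)) , <-trans c<a
    int-high : ∀ {β c} → ¬ (β < x) → c ≡ β ⊎ NoMore t β × β < c → Int t x β c
    int-high β≮x (inj₁ refl)      = int-self {t} {x}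
    int-high β≮x (inj₂ (n , β<c)) u au =
      (λ u<β → <-trans u<β β<c) , (λ β<u → contradiction (above-convex> b β<u β≮x au) (n u β<u))
    before : ∀ {lo hi w} → Within lo hi x → LeftFirst t lo hi F → RightFirst t lo hi F →
             (∀ {c} → Int t x v c → In lo hi c) → Bound lo hi w → Before (Int t x w) (Int t x v) F
    before (x≮lo , _) lf rf f (inj₁ refl) = Before-map (int-low (x≮lo ∘ [<])) f (lf _ refl)
    before (_ , hi≮x) lf rf f (inj₂ refl) = Before-map (int-high (hi≮x ∘ [<])) f (rf _ refl)

  -- Placement determines the tree

  -- The descent to `k` maintains an end of the current interval that lies in (lo , hi); below the
  -- root of `T` it is the parent of the current node. `Protected` keeps `k` from being above that
  -- end.
  placed-not-above : ∀ T {lo hi lo′ hi′ t k w} → Allᵗ (In lo hi) U T → Placed T lo′ hi′ t → k ∈ᵗ T →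
                     Bound lo′ hi′ w → In lo hi w → ¬ (∀ u → In lo hi u → Above t k u)
  placed-not-above (node l v r) _              (pr , _ , _) here        bw w∈ ab = pr _ bw (ab _ w∈)
  placed-not-above (node l v r) (node al i _) (_ , pl , _) (left _ p)  bw w∈ ab =
    placed-not-above l al pl p (inj₂ refl) i ab
  placed-not-above (node l v r) (node _ i ar) (_ , _ , pr) (right _ p) bw w∈ ab =
    placed-not-above r ar pr p (inj₁ refl) i ab

  ∈-left : ∀ {l v r k} → k < v → k ∈ᵗ node l v r → k ∈ᵗ l
  ∈-left k<v here          = contradiction k<v (irrefl refl)
  ∈-left k<v (left _ p)    = p
  ∈-left k<v (right v<k _) = contradiction v<k (asym k<v)

  ∈-right : ∀ {l v r k} → v < k → k ∈ᵗ node l v r → k ∈ᵗ r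
  ∈-right v<k here         = contradiction v<k (irrefl refl)
  ∈-right v<k (left k<v _) = contradiction v<k (asym k<v)
  ∈-right v<k (right _ p)  = p

  -- `s` is a part of the tree `t`, and `emb` relates its ancestors to those in `t`, of which
  -- `Placed` speaks. The root of `s` is above the whole range, so by `placed-not-above` it cannot
  -- be a proper descendant in `T`.
  placed-unique : ∀ T s {lo hi t} → IsBST T → IsBST s → Fits lo hi T → Placed T lo hi t →
                  (∀ k → k ∈ᵗ s → k ∈ᵗ T) → (∀ k → k ∈ᵗ T → k ∈ᵗ s) →
                  (∀ c w → In lo hi w → Above s c w → Above t c w) → s ≡ T
  placed-unique (leaf _)     (leaf _)     _ _ _ _ _ _ _ = refl
  placed-unique (leaf _)     (node l k r) _ _ _ _ s⊆T _ _ with s⊆T k here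
  ... | ()
  placed-unique (node l v r) (leaf _) _ _ _ _ _ T⊆s _ with T⊆s v here
  ... | ()
  placed-unique (node l v r) (node l′ k r′) (node l<v v<r bl br) (node l′<k k<r′ bl′ br′)
                (i , fl , fr) (_ , pl , pr) s⊆T T⊆s emb
    with s⊆T k here
  ... | left _ p  = contradiction (λ u u∈ → emb k u u∈ here)
                      (placed-not-above l (mapₙ (in-widenˡ (proj₂ i)) (fits-all l fl)) pl p (inj₂ refl) i)
  ... | right _ p = contradiction (λ u u∈ → emb k u u∈ here)
                      (placed-not-above r (mapₙ (in-widenʳ (proj₁ i)) (fits-all r fr)) pr p (inj₁ refl) i)
  ... | here = cong₂ (λ l r → node l v r)
    (placed-unique l l′ bl bl′ fl pl
      (λ k p → let k<v = all-above l′<k p in ∈-left k<v (s⊆T k (left k<v p)))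
      (λ k p → let k<v = all-above l<v p in ∈-left k<v (T⊆s k (left k<v p)))
      (λ c w w∈ p → emb c w (in-widenˡ (proj₂ i) w∈) (left ([<]-injective (proj₂ w∈)) p)))
    (placed-unique r r′ br br′ fr pr
      (λ k p → let v<k = all-above k<r′ p in ∈-right v<k (s⊆T k (right v<k p)))
      (λ k p → let v<k = all-above v<r p in ∈-right v<k (T⊆s k (right v<k p)))
      (λ c w w∈ p → emb c w (in-widenʳ (proj₁ i) w∈) (right ([<]-injective (proj₁ w∈)) p)))

  -- The forcing sequence

  opt : K ± → List K
  opt [ k ] = k ∷ []
  opt _     = []

  -- A query of v itself stands in for the query of an infinite end of its interval.
  clip : K → K ± → K
  clip v [ k ] = k
  clip v _     = v

  -- At the last query, the ends that are keys have to be on its search path.  Between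
  -- two finite ends, the query before it changes nothing: it asks for the root, and
  -- serves to have made it the root.  After the query of v that precedes a recursive
  -- call, the keys above v are all on the side of that call.
  build : K ± → BinTree K → K ± → List K
  build lo (leaf _) hi = []
  build lo (node l v r@(node _ _ _)) hi =
    build lo l [ v ] ++ v ∷ build [ v ] r hi ++ clip v hi ∷ clip v lo ∷ []
  build lo (node (leaf _) v (leaf _)) hi = opt hi ++ opt hi ++ opt lo
  build lo (node l@(node _ _ _) v (leaf _)) hi =
    v ∷ build lo l [ v ] ++ clip v lo ∷ clip v hi ∷ []

  NonEmpty : BinTree K → Set
  NonEmpty (leaf _)     = ⊥
  NonEmpty (node _ _ _) = ⊤

  module _ {p} {P : K → Set p} where

    opt-all : ∀ b → (∀ w → b ≡ [ w ] → P w) → All P (opt b)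
    opt-all ⊥±    f = All.[]
    opt-all [ k ] f = f k refl All.∷ All.[]
    opt-all ⊤±    f = All.[]

    clip-all : ∀ {v} b → P v → (∀ w → b ≡ [ w ] → P w) → P (clip v b)
    clip-all ⊥±    p f = p
    clip-all [ k ] p f = f k refl
    clip-all ⊤±    p f = p

    build-all : ∀ {lo} T {hi} → Allᵗ P U T → (∀ w → Bound lo hi w → P w) → All P (build lo T hi)
    build-all (leaf _) _ f = All.[]
    build-all {lo} (node l v r@(node _ _ _)) {hi} (node al p ar) f = All.++⁺
      (build-all l al λ { w (inj₁ e) → f w (inj₁ e) ; w (inj₂ refl) → p })
      (p All.∷ All.++⁺ (build-all r ar λ { w (inj₁ refl) → p ; w (inj₂ e) → f w (inj₂ e) })
        (clip-all hi p (λ w → f w ∘ inj₂) All.∷ clip-all lo p (λ w → f w ∘ inj₁) All.∷ All.[]))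
    build-all {lo} (node (leaf _) v (leaf _)) {hi} _ f =
      All.++⁺ (opt-all hi (λ w → f w ∘ inj₂))
        (All.++⁺ (opt-all hi (λ w → f w ∘ inj₂)) (opt-all lo (λ w → f w ∘ inj₁)))
    build-all {lo} (node l@(node _ _ _) v (leaf _)) {hi} (node al p _) f = p All.∷ All.++⁺
      (build-all l al λ { w (inj₁ e) → f w (inj₁ e) ; w (inj₂ refl) → p })
      (clip-all lo p (λ w → f w ∘ inj₁) All.∷ clip-all hi p (λ w → f w ∘ inj₂) All.∷ All.[])

  build-bound : ∀ {lo} T {hi} → NonEmpty T → ∀ {w} → Bound lo hi w → w ∈ build lo T hi
  build-bound (node l v r@(node _ _ _)) _ (inj₁ refl) =
    ∈-++⁺ʳ (build _ l _) (there (∈-++⁺ʳ (build _ r _) (there (here refl))))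
  build-bound (node l v r@(node _ _ _)) _ (inj₂ refl) =
    ∈-++⁺ʳ (build _ l _) (there (∈-++⁺ʳ (build _ r _) (here refl)))
  build-bound (node (leaf _) v (leaf _)) {hi} _ (inj₁ refl) = ∈-++⁺ʳ (opt hi) (∈-++⁺ʳ (opt hi) (here refl))
  build-bound (node (leaf _) v (leaf _)) _ (inj₂ refl) = here refl
  build-bound (node l@(node _ _ _) v (leaf _)) _ (inj₁ refl) = there (∈-++⁺ʳ (build _ l _) (here refl))
  build-bound (node l@(node _ _ _) v (leaf _)) _ (inj₂ refl) = there (∈-++⁺ʳ (build _ l _) (there (here refl)))

  in⇒within : ∀ {lo hi c} → In lo hi c → Within lo hi c
  in⇒within (lo<c , c<hi) = <±-asym asym lo<c , <±-asym asym c<hi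

  bound-within : ∀ {lo hi v w} → In lo hi v → Bound lo hi w → Within lo hi w
  bound-within (lo<v , v<hi) (inj₁ refl) =
    (λ p → irrefl refl ([<]-injective p)) , <±-asym asym (<±-trans <-trans lo<v v<hi)
  bound-within (lo<v , v<hi) (inj₂ refl) =
    <±-asym asym (<±-trans <-trans lo<v v<hi) , (λ p → irrefl refl ([<]-injective p))

  build-within : ∀ {lo} T {hi} → Fits lo hi T → All (Within lo hi) (build lo T hi)
  build-within (leaf _)       _ = All.[]
  build-within T@(node _ _ _) f@(i , _) = build-all T (mapₙ in⇒within (fits-all T f)) (λ w → bound-within i)

  -- Correctness of the sequence for a subtree

  -- The second component is for the caller: the last query has the finite ends on its path, so an
  -- end that is asked next becomes the root.
  Result : BinTree K → K ± → K ± → List K → BinTree K → Set (a ⊔ ℓ)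
  Result T lo hi F t = Placed T lo hi t × (NonEmpty T → ∀ w F′ → F ≡ w ∷ F′ → Bound lo hi w → Rooted t w)

  -- `first` is used at the last query but demanded of the tree before the first one; queries in the
  -- closed interval preserve it.
  record Pre (T : BinTree K) (lo hi : K ±) (F : List K) (t : BinTree K) : Set (a ⊔ ℓ) where
    field
      bst   : IsBST t
      fit   : Fits lo hi T
      keys∈ : Allᵗ (_∈ᵗ t) U T
      ends∈ : ∀ w → Bound lo hi w → w ∈ᵗ t
      first : LeftFirst t lo hi F × RightFirst t lo hi F

  leftFirst-run : ∀ {t lo hi F} xs G → IsBST t → All (λ x → ¬ ([ x ] <± lo)) xs →
                  LeftFirst t lo hi F → LeftFirst (run xs G t) lo hi F
  leftFirst-run xs G b x≮lo lf a refl = Before-map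
    (Sum.map id λ (n , c<a) → noLess-run xs G b (All.map (_∘ [<]) x≮lo) n , c<a) id (lf a refl)

  rightFirst-run : ∀ {t lo hi F} xs G → IsBST t → All (λ x → ¬ (hi <± [ x ])) xs →
                  RightFirst t lo hi F → RightFirst (run xs G t) lo hi F
  rightFirst-run xs G b hi≮x rf a refl = Before-map
    (Sum.map id λ (n , c<a) → noMore-run xs G b (All.map (_∘ [<]) hi≮x) n , c<a) id (rf a refl)

  first-run : ∀ {t lo hi F} xs G → IsBST t → All (Within lo hi) xs →
              LeftFirst t lo hi F × RightFirst t lo hi F →
              LeftFirst (run xs G t) lo hi F × RightFirst (run xs G t) lo hi F
  first-run xs G b ws (lf , rf) =
    leftFirst-run xs G b (All.map proj₁ ws) lf , rightFirst-run xs G b (All.map proj₂ ws) rf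

  last-query : ∀ {lo v hi t x F} {A : Set} → IsBST t → In lo hi v → Within lo hi x →
               (∀ w → Bound lo hi w → Above t w x) →
               LeftFirst t lo hi F × RightFirst t lo hi F →
               Protected (serve x F t) lo v hi ×
               (A → ∀ w F′ → F ≡ w ∷ F′ → Bound lo hi w → Rooted (serve x F t) w)
  last-query b i wi ab (lf , rf) = push _ _ b i wi ab lf rf , λ { _ w F′ refl bw → next-root b (ab w bw) }

  clip-∉ˡ : ∀ {v} lo → ¬ In lo [ v ] (clip v lo)
  clip-∉ˡ ⊥±    (_ , p) = irrefl refl ([<]-injective p)
  clip-∉ˡ [ k ] (p , _) = irrefl refl ([<]-injective p)
  clip-∉ˡ ⊤±    (() , _)

  clip-∉ʳ : ∀ {v} hi → ¬ In [ v ] hi (clip v hi)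
  clip-∉ʳ ⊥±    (p , _) = irrefl refl ([<]-injective p)
  clip-∉ʳ [ k ] (_ , p) = irrefl refl ([<]-injective p)
  clip-∉ʳ ⊤±    (p , _) = irrefl refl ([<]-injective p)

  clip≤ : ∀ {v lo} → lo <± [ v ] → clip v lo ≡ v ⊎ clip v lo < v
  clip≤ ⊥±<[ _ ]             = inj₁ refl
  clip≤ AddExtrema.[ a<v ] = inj₂ a<v

  clip≥ : ∀ {v hi} → [ v ] <± hi → clip v hi ≡ v ⊎ v < clip v hi
  clip≥ [ _ ]<⊤±             = inj₁ refl
  clip≥ AddExtrema.[ v<b ] = inj₂ v<b

  ≤⇒≯ : ∀ {x v} → x ≡ v ⊎ x < v → ¬ (v < x)
  ≤⇒≯ (inj₁ refl) = irrefl refl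
  ≤⇒≯ (inj₂ x<v)  = asym x<v

  ≥⇒≮ : ∀ {x v} → x ≡ v ⊎ v < x → ¬ (x < v)
  ≥⇒≮ (inj₁ refl) = irrefl refl
  ≥⇒≮ (inj₂ v<x)  = asym v<x

  clip-within : ∀ {lo hi v} b → In lo hi v → (∀ w → b ≡ [ w ] → Bound lo hi w) → Within lo hi (clip v b)
  clip-within b i f = clip-all b (in⇒within i) (λ w e → bound-within i (f w e))

  clip-boundˡ : ∀ {v} lo → Bound lo [ v ] (clip v lo)
  clip-boundˡ ⊥±    = inj₂ refl
  clip-boundˡ [ _ ] = inj₁ refl
  clip-boundˡ ⊤±    = inj₂ refl

  clip-boundʳ : ∀ {v} hi → Bound [ v ] hi (clip v hi)
  clip-boundʳ ⊥±    = inj₁ refl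
  clip-boundʳ [ _ ] = inj₂ refl
  clip-boundʳ ⊤±    = inj₁ refl

  within-widenˡ : ∀ {lo hi v x} → [ v ] <± hi → Within lo [ v ] x → Within lo hi x
  within-widenˡ v<hi (x≮lo , v≮x) = x≮lo , λ hi<x → v≮x (<±-trans <-trans v<hi hi<x)

  within-widenʳ : ∀ {lo hi v x} → lo <± [ v ] → Within [ v ] hi x → Within lo hi x
  within-widenʳ lo<v (x≮v , hi≮x) = (λ x<lo → x≮v (<±-trans <-trans x<lo lo<v)) , hi≮x

  allˡ : ∀ {p} {P : K → Set p} {l v r} → Allᵗ P U (node {L = ⊤} l v r) → Allᵗ P U l
  allˡ (node al _ _) = al

  allᵛ : ∀ {p} {P : K → Set p} {l v r} → Allᵗ P U (node {L = ⊤} l v r) → P v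
  allᵛ (node _ p _) = p

  allʳ : ∀ {p} {P : K → Set p} {l v r} → Allᵗ P U (node {L = ⊤} l v r) → Allᵗ P U r
  allʳ (node _ _ ar) = ar

  Correct : BinTree K → K ± → K ± → Set (a ⊔ ℓ)
  Correct T lo hi = ∀ F t → Pre T lo hi F t → Result T lo hi F (run (build lo T hi) F t)

  -- The call for `l` is followed by α and β, where β may differ from its end `v`. The sequence for
  -- `l` asks `v` and nothing larger, so after the opening query of `v` no larger key is above `v`,
  -- and β ≥ v hits the interval of τ(v).
  build-left : ∀ {l v lo hi} → NonEmpty l → Correct l lo [ v ] → Correct (node l v (leaf _)) lo hi
  build-left {l@(node _ _ _)} {v} {lo} {hi} _ correct-l F t₀ pre =
    subst (Result (node l v (leaf _)) lo hi F)
      (sym (trans (run-++ (build lo l [ v ]) (α ∷ β ∷ []) F t₁) (cong (serve β F) (serve-root (β ∷ F) rooted))))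
      ((proj₁ pushed , placed-serve l β F bst₂ fl β∉ (proj₁ res-l) , _) , proj₂ pushed)
    where
    open Pre pre
    i    = proj₁ fit
    fl   = proj₁ (proj₂ fit)
    v∈ : v ∈ᵗ t₀
    v∈   = allᵛ keys∈
    α    = clip v lo
    β    = clip v hi
    F₁   = (build lo l [ v ] ++ α ∷ β ∷ []) ++ F
    t₁   = serve v F₁ t₀
    t₂   = run (build lo l [ v ]) (α ∷ β ∷ F) t₁
    bst₁ = serve-bst v F₁ t₀ bst
    bst₂ = run-bst (build lo l [ v ]) (α ∷ β ∷ F) t₁ bst₁
    β∉ : ¬ In lo [ v ] β
    β∉ (_ , β<v) = ≥⇒≮ (clip≥ (proj₂ i)) ([<]-injective β<v)
    l-within : All (Within lo [ v ]) (build lo l [ v ])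
    l-within = build-within l fl
    noMore : NoMore t₁ v
    noMore = noMore-serve bst v∈ (before-++ˡ (before-++ˡ (before-∈ (build-bound l _ (inj₂ refl))
               (All.map (λ (_ , v≮x) → v≮x ∘ [<]) l-within) refl)))
    pre-l : Pre l lo [ v ] (α ∷ β ∷ F) t₁
    pre-l = record
      { bst   = bst₁
      ; fit   = fl
      ; keys∈ = mapₙ (serve-∈⁺ v F₁ t₀ bst) (allˡ keys∈)
      ; ends∈ = λ { w (inj₁ e)    → serve-∈⁺ v F₁ t₀ bst (ends∈ w (inj₁ e))
                  ; w (inj₂ refl) → serve-∈⁺ v F₁ t₀ bst v∈ }
      ; first = (λ { _ refl → here (inj₁ refl) (clip-∉ˡ lo) })
              , (λ { _ refl → there (clip-∉ˡ lo) (here (Sum.map₂ (noMore ,_) (clip≥ (proj₂ i))) β∉) })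
      }
    res-l  = correct-l (α ∷ β ∷ F) t₁ pre-l
    rooted : Rooted t₂ α
    rooted = proj₂ res-l _ α (β ∷ F) refl (clip-boundˡ lo)
    above-β : ∀ w → Bound lo hi w → Above t₂ w β
    above-β w (inj₁ refl) = rooted-above rooted
    above-β w (inj₂ refl) = run-∈ (build lo l [ v ]) (α ∷ β ∷ F) t₁ bst₁
      (serve-∈⁺ v F₁ t₀ bst (ends∈ w (inj₂ refl)))
    pushed = last-query {A = ⊤} bst₂ i (clip-within hi i (λ _ → inj₂)) above-β
      (first-run (build lo l [ v ]) (α ∷ β ∷ F) bst₁ (All.map (within-widenˡ (proj₂ i)) l-within)
        (first-run (v ∷ []) F₁ bst (in⇒within i All.∷ All.[]) first))

  -- The call for `l` finds `v` as the next query and α later, with only queries outside (lo , v) in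
  -- between. For `r` the end β comes next, and α ≤ v then acts for `v`, above which the query of
  -- `v` has left no smaller key. All queries after the call for `l` avoid (lo , v), so `l` stays
  -- placed.
  build-right : ∀ {l v r lo hi} → NonEmpty r → Correct l lo [ v ] → Correct r [ v ] hi → Correct (node l v r) lo hi
  build-right {l} {v} {r@(node _ _ _)} {lo} {hi} _ correct-l correct-r F t₀ pre =
    subst (Result (node l v r) lo hi F)
      (sym (trans (run-++ (build lo l [ v ]) (v ∷ ys) F t₀)
        (trans (run-++ (build [ v ] r hi) (β ∷ α ∷ []) F t₂) (cong (serve α F) (serve-root (α ∷ F) rooted)))))
      ((proj₁ pushed , placed-serve l α F bst₃ fl (clip-∉ˡ lo) placed-l ,
        placed-serve r α F bst₃ fr α∉ (proj₁ res-r)) , proj₂ pushed)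
    where
    open Pre pre
    i    = proj₁ fit
    fl   = proj₁ (proj₂ fit)
    fr   = proj₂ (proj₂ fit)
    v∈ : v ∈ᵗ t₀
    v∈   = allᵛ keys∈
    α    = clip v lo
    β    = clip v hi
    ys   = build [ v ] r hi ++ β ∷ α ∷ []
    F₁   = v ∷ ys ++ F
    t₁   = run (build lo l [ v ]) F₁ t₀
    t₂   = serve v (ys ++ F) t₁
    t₃   = run (build [ v ] r hi) (β ∷ α ∷ F) t₂
    bst₁ = run-bst (build lo l [ v ]) F₁ t₀ bst
    bst₂ = serve-bst v (ys ++ F) t₁ bst₁
    bst₃ = run-bst (build [ v ] r hi) (β ∷ α ∷ F) t₂ bst₂
    ∈₁ : ∀ {k} → k ∈ᵗ t₀ → k ∈ᵗ t₁
    ∈₁ = run-∈ (build lo l [ v ]) F₁ t₀ bst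
    ∈₂ : ∀ {k} → k ∈ᵗ t₀ → k ∈ᵗ t₂
    ∈₂ = serve-∈⁺ v (ys ++ F) t₁ bst₁ ∘ ∈₁
    α∉ : ¬ In [ v ] hi α
    α∉ (v<α , _) = ≤⇒≯ (clip≤ (proj₁ i)) ([<]-injective v<α)
    v∉ : ¬ In lo [ v ] v
    v∉ (_ , v<v) = irrefl refl ([<]-injective v<v)
    l-within : All (Within lo [ v ]) (build lo l [ v ])
    l-within = build-within l fl
    r-within : All (Within [ v ] hi) (build [ v ] r hi)
    r-within = build-within r fr
    r∉ : All (¬_ ∘ In lo [ v ]) (build [ v ] r hi)
    r∉ = All.map (λ (x≮v , _) (_ , x<v) → x≮v x<v) r-within
    ys∉ : All (¬_ ∘ In lo [ v ]) ys
    ys∉ = All.++⁺ r∉ ((λ (_ , β<v) → ≥⇒≮ (clip≥ (proj₂ i)) ([<]-injective β<v)) All.∷ clip-∉ˡ lo All.∷ All.[])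
    pre-l : Pre l lo [ v ] F₁ t₀
    pre-l = record
      { bst   = bst
      ; fit   = fl
      ; keys∈ = allˡ keys∈
      ; ends∈ = λ { w (inj₁ e) → ends∈ w (inj₁ e) ; w (inj₂ refl) → v∈ }
      ; first = (λ { _ refl → there v∉ (before-++ˡ
                  (before-∈ (∈-++⁺ʳ (build [ v ] r hi) (there (here refl))) ys∉ (inj₁ refl))) })
              , (λ { _ refl → here (inj₁ refl) v∉ })
      }
    placed-l : Placed l lo [ v ] t₃
    placed-l = placed-run l (build [ v ] r hi) (β ∷ α ∷ F) bst₂ fl r∉
      (placed-serve l v (ys ++ F) bst₁ fl v∉ (proj₁ (correct-l F₁ t₀ pre-l)))
    noLess : NoLess t₂ v
    noLess = noLess-serve bst₁ (∈₁ v∈) (before-++ˡ (before-++ˡ (before-∈ (build-bound r _ (inj₁ refl))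
               (All.map (λ (x≮v , _) → x≮v ∘ [<]) r-within) refl)))
    pre-r : Pre r [ v ] hi (β ∷ α ∷ F) t₂
    pre-r = record
      { bst   = bst₂
      ; fit   = fr
      ; keys∈ = mapₙ ∈₂ (allʳ keys∈)
      ; ends∈ = λ { w (inj₁ refl) → ∈₂ v∈ ; w (inj₂ e) → ∈₂ (ends∈ w (inj₂ e)) }
      ; first = (λ { _ refl → there (clip-∉ʳ hi) (here (Sum.map₂ (noLess ,_) (clip≤ (proj₁ i))) α∉) })
              , (λ { _ refl → here (inj₁ refl) (clip-∉ʳ hi) })
      }
    res-r  = correct-r (β ∷ α ∷ F) t₂ pre-r
    rooted : Rooted t₃ β
    rooted = proj₂ res-r _ β (α ∷ F) refl (clip-boundʳ hi)
    above-α : ∀ w → Bound lo hi w → Above t₃ w α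
    above-α w (inj₁ refl) = run-∈ (build [ v ] r hi) (β ∷ α ∷ F) t₂ bst₂ (∈₂ (ends∈ w (inj₁ refl)))
    above-α w (inj₂ refl) = rooted-above rooted
    pushed = last-query {A = ⊤} bst₃ i (clip-within lo i (λ _ → inj₁)) above-α
      (first-run (build [ v ] r hi) (β ∷ α ∷ F) bst₂ (All.map (within-widenʳ (proj₁ i)) r-within)
        (first-run (v ∷ []) (ys ++ F) bst₁ (in⇒within i All.∷ All.[])
          (first-run (build lo l [ v ]) F₁ bst (All.map (within-widenˡ (proj₂ i)) l-within) first)))

  build-correct : ∀ T lo hi → Correct T lo hi
  build-correct (leaf _) lo hi F t pre = _ , λ ()
  build-correct (node (leaf _) v (leaf _)) ⊥± ⊤± F t pre =
    ((λ { _ (inj₁ ()) ; _ (inj₂ ()) }) , _ , _) , λ { _ _ _ _ (inj₁ ()) ; _ _ _ _ (inj₂ ()) }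
  build-correct (node (leaf _) v (leaf _)) [ a ] ⊤± F t pre =
    let pr , rt = last-query bst i (bound-within i (inj₁ refl)) (λ { w (inj₁ refl) → ends∈ w (inj₁ refl) }) first
    in (pr , _ , _) , rt
    where open Pre pre
          i = proj₁ fit
  build-correct (node (leaf _) v (leaf _)) ⊥± [ b ] F t pre =
    -- Here the second query of `b` is the one that pushes; the first has to preserve `first` and
    -- the presence of `b`.
    let pr , rt = last-query (serve-bst b _ t bst) i wb
                         (λ { w (inj₂ refl) → serve-∈⁺ b _ t bst (ends∈ w (inj₂ refl)) })
                         (first-run (b ∷ []) (b ∷ F) bst (wb All.∷ All.[]) first)
    in (pr , _ , _) , rt
    where open Pre pre
          i = proj₁ fit
          wb = bound-within i (inj₂ refl)
  build-correct (node (leaf _) v (leaf _)) [ a ] [ b ] F t pre =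
    subst (λ t → Result (node (leaf _) v (leaf _)) [ a ] [ b ] F (serve a F t))
      (sym (serve-root (a ∷ F) rooted))
      (let pr , rt = last-query bst₁ i (bound-within i (inj₁ refl))
                       (λ { w (inj₁ refl) → serve-∈⁺ b _ t bst (ends∈ w (inj₁ refl))
                         ; w (inj₂ refl) → rooted-above rooted })
                       (first-run (b ∷ []) (b ∷ a ∷ F) bst (wb All.∷ All.[]) first)
       in (pr , _ , _) , rt)
    where open Pre pre
          i = proj₁ fit
          wb = bound-within i (inj₂ refl)
          bst₁ = serve-bst b (b ∷ a ∷ F) t bst
          rooted : Rooted (serve b (b ∷ a ∷ F) t) b
          rooted = next-root bst (ends∈ b (inj₂ refl))
  build-correct (node (leaf _) v (leaf _)) ⊤± hi F t record { fit = (() , _) , _ }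
  build-correct (node (leaf _) v (leaf _)) [ _ ] ⊥± F t record { fit = (_ , Sup.[ () ]) , _ }
  build-correct (node (leaf _) v (leaf _)) ⊥± ⊥± F t record { fit = (_ , Sup.[ () ]) , _ }
  build-correct (node l@(node _ _ _) v (leaf _)) lo hi = build-left _ (build-correct l lo [ v ])
  build-correct (node l v r@(node _ _ _)) lo hi = build-right _ (build-correct l lo [ v ]) (build-correct r [ v ] hi)

  -- Three queries per node

  opt-length : ∀ b → length (opt b) ≤ 1
  opt-length ⊥±    = ℕ.z≤n
  opt-length [ _ ] = ℕ.s≤s ℕ.z≤n
  opt-length ⊤±    = ℕ.z≤n

  build-length : ∀ lo T hi → length (build lo T hi) ≤ 3 * #nodes T
  build-length lo (leaf _) hi = ℕ.z≤n
  build-length lo (node (leaf _) v (leaf _)) hi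
    rewrite length-++ (opt hi) {opt hi ++ opt lo} | length-++ (opt hi) {opt lo} =
    ℕ.+-mono-≤ (opt-length hi) (ℕ.+-mono-≤ (opt-length hi) (opt-length lo))
  build-length lo (node l@(node _ _ _) v (leaf _)) hi = begin
    suc (length (build lo l [ v ] ++ clip v lo ∷ clip v hi ∷ [])) ≡⟨ cong suc (length-++ (build lo l [ v ])) ⟩
    suc (length (build lo l [ v ]) + 2)                           ≤⟨ ℕ.s≤s (ℕ.+-monoˡ-≤ 2 (build-length lo l [ v ])) ⟩
    suc (3 * #nodes l + 2)                                        ≡⟨ arith (#nodes l) ⟩
    3 * (#nodes l + 1)                                            ∎
    where
    open ℕ.≤-Reasoning
    arith : ∀ m → suc (3 * m + 2) ≡ 3 * (m + 1)
    arith = solve-∀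
  build-length lo (node l v r@(node _ _ _)) hi = begin
    length (build lo l [ v ] ++ v ∷ build [ v ] r hi ++ ys)
      ≡⟨ length-++ (build lo l [ v ]) ⟩
    length (build lo l [ v ]) + suc (length (build [ v ] r hi ++ ys))
      ≡⟨ cong (λ m → length (build lo l [ v ]) + suc m) (length-++ (build [ v ] r hi)) ⟩
    length (build lo l [ v ]) + suc (length (build [ v ] r hi) + 2)
      ≤⟨ ℕ.+-mono-≤ (build-length lo l [ v ]) (ℕ.s≤s (ℕ.+-monoˡ-≤ 2 (build-length [ v ] r hi))) ⟩
    3 * #nodes l + suc (3 * #nodes r + 2)
      ≡⟨ arith (#nodes l) (#nodes r) ⟩
    3 * (#nodes l + suc (#nodes r))                                     ∎
    where
    open ℕ.≤-Reasoning
    ys = clip v hi ∷ clip v lo ∷ []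
    arith : ∀ m n → 3 * m + suc (3 * n + 2) ≡ 3 * (m + suc n)
    arith = solve-∀

  -- Key lists and tree membership

  module _ {p} {P : K → Set p} where

    toDiffList-all⁺ : ∀ {t : BinTree K} {ks} → Allᵗ P U t → All P ks → All P (Infix.toDiffList t ks)
    toDiffList-all⁺ (leaf _)       ps = ps
    toDiffList-all⁺ (node al p ar) ps = toDiffList-all⁺ al (p All.∷ toDiffList-all⁺ ar ps)

    toDiffList-all⁻ : ∀ (t : BinTree K) {ks} → All P (Infix.toDiffList t ks) → Allᵗ P U t × All P ks
    toDiffList-all⁻ (leaf _)     ps = leaf _ , ps
    toDiffList-all⁻ (node l v r) ps with toDiffList-all⁻ l ps
    ... | al , p All.∷ ps′ with toDiffList-all⁻ r ps′
    ...   | ar , ps″ = node al p ar , ps″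

  ∈-keys⁻ : ∀ {t k} → IsBST t → k ∈ keys t → k ∈ᵗ t
  ∈-keys⁻ b = All.lookup (toDiffList-all⁺ (all-∈ b) All.[])

  keys-all : ∀ t → Allᵗ (_∈ keys t) U t
  keys-all t = proj₁ (toDiffList-all⁻ t (All.tabulate id))

  ∈-keys⁺ : ∀ {t k} → k ∈ᵗ t → k ∈ keys t
  ∈-keys⁺ {t} = all-above (keys-all t)

  inside : ∀ {k} → In ⊥± ⊤± k
  inside = ⊥±<[ _ ] , [ _ ]<⊤±

  -- The final query makes the queries before it bring v to the root, and then leaves
  -- the tree unchanged whatever follows.
  forcing : BinTree K → K → BinTree K → List K
  forcing l v r = build ⊥± l [ v ] ++ build [ v ] r ⊤± ++ v ∷ []

  forcing-length : ∀ l v r → length (forcing l v r) ≤ 3 * (#nodes l + #nodes r) + 1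
  forcing-length l v r = begin
    length (build ⊥± l [ v ] ++ build [ v ] r ⊤± ++ v ∷ [])
      ≡⟨ length-++ (build ⊥± l [ v ]) ⟩
    length (build ⊥± l [ v ]) + length (build [ v ] r ⊤± ++ v ∷ [])
      ≡⟨ cong (length (build ⊥± l [ v ]) +_) (length-++ (build [ v ] r ⊤±)) ⟩
    length (build ⊥± l [ v ]) + (length (build [ v ] r ⊤±) + 1)
      ≤⟨ ℕ.+-mono-≤ (build-length ⊥± l [ v ]) (ℕ.+-monoˡ-≤ 1 (build-length [ v ] r ⊤±)) ⟩
    3 * #nodes l + (3 * #nodes r + 1)
      ≡⟨ arith (#nodes l) (#nodes r) ⟩
    3 * (#nodes l + #nodes r) + 1                                    ∎
    where
    open ℕ.≤-Reasoning
    arith : ∀ m n → 3 * m + (3 * n + 1) ≡ 3 * (m + n) + 1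
    arith = solve-∀

  forcing-all : ∀ l v r → All (_∈ keys (node l v r)) (forcing l v r)
  forcing-all l v r = go (keys-all (node l v r))
    where
    go : Allᵗ (_∈ keys (node l v r)) U (node l v r) → All (_∈ keys (node l v r)) (forcing l v r)
    go (node al p ar) = All.++⁺ (build-all l al (λ { _ (inj₂ refl) → p }))
      (All.++⁺ (build-all r ar (λ { _ (inj₁ refl) → p })) (p All.∷ All.[]))

  -- Correctness for the whole tree

  module _ {T T₀ : BinTree K} (bT : IsBST T) (b₀ : IsBST T₀)
           (⊆ : ∀ k → k ∈ᵗ T₀ → k ∈ᵗ T) (⊇ : ∀ k → k ∈ᵗ T → k ∈ᵗ T₀) where

    placed⇒≡ : ∀ xs F → Placed T ⊥± ⊤± (run xs F T₀) → run xs F T₀ ≡ T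
    placed⇒≡ xs F pl = placed-unique T _ bT (run-bst xs F _ b₀) (fits bT (mapₙ (λ _ → inside) (all-∈ bT))) pl
      (λ k p → ⊆ k (run-∈⁻ xs F _ b₀ p)) (λ k p → run-∈ xs F _ b₀ (⊇ k p)) (λ _ _ _ p → p)

  -- The root of the target has no finite end, so placing both children suffices; the queries for
  -- `r` are at least `v` and keep `l` placed. A nonempty child is what brings `v` to the root
  -- before the final query.
  forcing-correct : ∀ {l v r t} → NonEmpty l ⊎ NonEmpty r → IsBST (node l v r) → IsBST t →
                    (∀ k → k ∈ᵗ t → k ∈ᵗ node l v r) → (∀ k → k ∈ᵗ node l v r → k ∈ᵗ t) →
                    ∀ Y → run (forcing l v r) Y t ≡ node l v r
  forcing-correct {l} {v} {r} {t} ne bT b ⊆ ⊇ Y =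
    placed⇒≡ bT b ⊆ ⊇ (forcing l v r) Y (subst (Placed (node l v r) ⊥± ⊤±) (sym run-≡)
      ((λ { _ (inj₁ ()) ; _ (inj₂ ()) }) , placed-run l (build [ v ] r ⊤±) (v ∷ Y) bst₁ fl r∉ (proj₁ res-l) ,
       proj₁ res-r))
    where
    F₁   = (build [ v ] r ⊤± ++ v ∷ []) ++ Y
    t₁   = run (build ⊥± l [ v ]) F₁ t
    t₂   = run (build [ v ] r ⊤±) (v ∷ Y) t₁
    bst₁ = run-bst (build ⊥± l [ v ]) F₁ t b
    all∈ : Allᵗ (_∈ᵗ t) U (node l v r)
    all∈ = mapₙ (⊇ _) (all-∈ bT)
    fT : Fits ⊥± ⊤± (node l v r)
    fT = fits bT (mapₙ (λ _ → inside) (all-∈ bT))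
    fl   = proj₁ (proj₂ fT)
    fr   = proj₂ (proj₂ fT)
    v∉ˡ : ¬ In ⊥± [ v ] v
    v∉ˡ (_ , v<v) = irrefl refl ([<]-injective v<v)
    v∉ʳ : ¬ In [ v ] ⊤± v
    v∉ʳ (v<v , _) = irrefl refl ([<]-injective v<v)
    r∉ : All (¬_ ∘ In ⊥± [ v ]) (build [ v ] r ⊤±)
    r∉ = All.map (λ (x≮v , _) (_ , x<v) → x≮v x<v) (build-within r fr)
    pre-l : Pre l ⊥± [ v ] F₁ t
    pre-l = record
      { bst   = b
      ; fit   = fl
      ; keys∈ = allˡ all∈
      ; ends∈ = λ { _ (inj₂ refl) → allᵛ all∈ }
      ; first = (λ _ ()) , (λ { _ refl → before-++ˡ
                  (before-∈ (∈-++⁺ʳ (build [ v ] r ⊤±) (here refl)) (All.++⁺ r∉ (v∉ˡ All.∷ All.[])) (inj₁ refl)) })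
      }
    res-l = build-correct l ⊥± [ v ] F₁ t pre-l
    pre-r : Pre r [ v ] ⊤± (v ∷ Y) t₁
    pre-r = record
      { bst   = bst₁
      ; fit   = fr
      ; keys∈ = mapₙ (run-∈ (build ⊥± l [ v ]) F₁ t b) (allʳ all∈)
      ; ends∈ = λ { _ (inj₁ refl) → run-∈ (build ⊥± l [ v ]) F₁ t b (allᵛ all∈) }
      ; first = (λ { _ refl → here (inj₁ refl) v∉ʳ }) , (λ _ ())
      }
    res-r = build-correct r [ v ] ⊤± (v ∷ Y) t₁ pre-r
    rooted : ∀ l r (ne : NonEmpty l ⊎ NonEmpty r) →
             let F₁ = (build [ v ] r ⊤± ++ v ∷ []) ++ Y ; t₁ = run (build ⊥± l [ v ]) F₁ t in
             Result l ⊥± [ v ] F₁ t₁ →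
             Result r [ v ] ⊤± (v ∷ Y) (run (build [ v ] r ⊤±) (v ∷ Y) t₁) →
             Rooted (run (build [ v ] r ⊤±) (v ∷ Y) t₁) v
    rooted l (node _ _ _) _         _       (_ , rt) = rt _ v Y refl (inj₁ refl)
    -- An empty `r` contributes no query, so `v` directly follows the sequence for `l`.
    rooted l (leaf _)     (inj₁ ne) (_ , rt) _       = rt ne v Y refl (inj₂ refl)
    run-≡ : run (forcing l v r) Y t ≡ t₂
    run-≡ = trans (run-++ (build ⊥± l [ v ]) (build [ v ] r ⊤± ++ v ∷ []) Y t)
             (trans (run-++ (build [ v ] r ⊤±) (v ∷ []) Y t₁) (serve-root Y (rooted l r ne res-l res-r)))

  singleton-correct : ∀ {v t} → IsBST t → (∀ k → k ∈ᵗ t → k ∈ᵗ node (leaf tt) v (leaf tt)) →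
                      (∀ k → k ∈ᵗ node (leaf tt) v (leaf tt) → k ∈ᵗ t) → t ≡ node (leaf tt) v (leaf tt)
  singleton-correct b ⊆ ⊇ = placed⇒≡ (node (leaf _) (leaf _) leaf leaf) b ⊆ ⊇ [] []
    ((λ { _ (inj₁ ()) ; _ (inj₂ ()) }) , _ , _)

  -- Numerical bounds

  d-positive : ∀ {l v r} → NonEmpty l ⊎ NonEmpty r → 0 ℕ.< d (node l v r)
  d-positive {l} {v} {r} ne =
    v<max⁺ 0 (0 ∷ map suc (nodeDepths l ++ nodeDepths r)) (inj₂ (there (positive l r ne)))
    where
    positive : ∀ l r → NonEmpty l ⊎ NonEmpty r → Any (0 ℕ.<_) (map suc (nodeDepths l ++ nodeDepths r))
    positive (node _ _ _) r            _ = here (ℕ.s≤s ℕ.z≤n)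
    positive (leaf _)     (node _ _ _) _ = here (ℕ.s≤s ℕ.z≤n)
    positive (leaf _)     (leaf _)     (inj₁ ())
    positive (leaf _)     (leaf _)     (inj₂ ())

  nonEmpty-size : ∀ {l r} → NonEmpty l ⊎ NonEmpty r → 1 ≤ #nodes l + #nodes r
  nonEmpty-size {node x _ y} {r} _ rewrite ℕ.+-suc (#nodes x) (#nodes y) = ℕ.s≤s ℕ.z≤n
  nonEmpty-size {leaf _} {node x _ y} _ rewrite ℕ.+-suc (#nodes x) (#nodes y) = ℕ.s≤s ℕ.z≤n
  nonEmpty-size {leaf _} {leaf _} (inj₁ ())
  nonEmpty-size {leaf _} {leaf _} (inj₂ ())

  size≡0 : ∀ (t : BinTree K) → #nodes t ≡ 0 → t ≡ leaf tt
  size≡0 (leaf _)     _  = refl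
  size≡0 (node l _ r) eq with trans (sym (ℕ.+-suc (#nodes l) (#nodes r))) eq
  ... | ()

  size≡1 : ∀ (t : BinTree K) → #nodes t ≡ 1 → ∃ λ k → t ≡ node (leaf tt) k (leaf tt)
  size≡1 (node l k r) eq =
    k , cong₂ (λ l r → node l k r) (size≡0 l (ℕ.m+n≡0⇒m≡0 _ eq′)) (size≡0 r (ℕ.m+n≡0⇒n≡0 (#nodes l) eq′))
    where eq′ = ℕ.suc-injective (trans (sym (ℕ.+-suc (#nodes l) (#nodes r))) eq)

  m+n≡1 : ∀ m n → m + n ≡ 1 → (m ≡ 0 × n ≡ 1) ⊎ (m ≡ 1 × n ≡ 0)
  m+n≡1 zero    n eq = inj₁ (refl , eq)
  m+n≡1 (suc m) n eq = inj₂ (cong suc (ℕ.m+n≡0⇒m≡0 m eq′) , ℕ.m+n≡0⇒n≡0 m eq′)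
    where eq′ = ℕ.suc-injective eq

  -- For two keys the general estimate is 4, but the quadratic bound is 3. The only child has an
  -- infinite end, which costs no query.
  forcing-length-2 : ∀ l v r → #nodes l + #nodes r ≡ 1 → length (forcing l v r) ≤ 3
  forcing-length-2 l v r eq with m+n≡1 (#nodes l) (#nodes r) eq
  forcing-length-2 l v r eq | inj₁ (p , q) with size≡0 l p | size≡1 r q
  ... | refl | _ , refl = ℕ.s≤s (ℕ.s≤s ℕ.z≤n)
  forcing-length-2 l v r eq | inj₂ (p , q) with size≡1 l p | size≡0 r q
  ... | _ , refl | refl = ℕ.≤-refl

3m+1≤3[1+m] : ∀ m → 3 * m + 1 ≤ 3 * suc m
3m+1≤3[1+m] m = ℕ.≤-trans (ℕ.m≤m+n (3 * m + 1) 2) (ℕ.≤-reflexive (arith m))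
  where
  arith : ∀ m → 3 * m + 1 + 2 ≡ 3 * suc m
  arith = solve-∀

-- Here n = m + 1, and 3m + 1 counts three queries for each node but the root, which takes one.
forcing-bound : ∀ {m L} e → 1 ≤ m → L ≤ 3 * m + 1 → (m ≡ 1 → L ≤ 3) →
                L ≤ (3 * suc m * (e + 1)) ⊓ (3 * (suc m * m) / 2)
forcing-bound {m} {L} e 1≤m L≤ L≤3 = ℕ.⊓-glb (begin
    L                    ≤⟨ L≤ ⟩
    3 * m + 1            ≤⟨ 3m+1≤3[1+m] m ⟩
    3 * suc m            ≤⟨ ℕ.m≤m*n (3 * suc m) (suc e) ⟩
    3 * suc m * suc e    ≡⟨ cong (3 * suc m *_) (ℕ.+-comm 1 e) ⟩
    3 * suc m * (e + 1)  ∎)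
  (quadratic m 1≤m L≤ L≤3)
  where
  open ℕ.≤-Reasoning
  -- For m = k + 2, the excess of 3(m + 1)m over 2(3m + 1) is 3k² + 9k + 4.
  arith : ∀ k → (3 * suc (suc k) + 1) * 2 + (3 * (k * k) + 9 * k + 4) ≡ 3 * (suc (suc (suc k)) * suc (suc k))
  arith = solve-∀
  quadratic : ∀ m → 1 ≤ m → L ≤ 3 * m + 1 → (m ≡ 1 → L ≤ 3) → L ≤ 3 * (suc m * m) / 2
  quadratic (suc zero)    _ _  L≤3 = L≤3 refl
  quadratic (suc (suc k)) _ L≤ _   = begin
    L                                          ≤⟨ L≤ ⟩
    3 * suc (suc k) + 1                        ≡⟨ ℕ.m*n/n≡m (3 * suc (suc k) + 1) 2 ⟨
    (3 * suc (suc k) + 1) * 2 / 2              ≤⟨ ℕ./-monoˡ-≤ 2 (ℕ.≤-trans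
                                                    (ℕ.m≤m+n ((3 * suc (suc k) + 1) * 2) (3 * (k * k) + 9 * k + 4))
                                                    (ℕ.≤-reflexive (arith k))) ⟩
    3 * (suc (suc (suc k)) * suc (suc k)) / 2  ∎

theorem6 : ∀ {a ℓ} → ∃ λ (C : ℕ) →
    ∀ {K : Set a} {_<_ : Rel K ℓ} (sto : IsStrictTotalOrder _≡_ _<_) →
    let open BST sto in
    ∀ (n : ℕ) .{{_ : NonZero n}} (T : BinTree K) → IsBST T → #nodes T ≡ n →
    ∃ λ (S : List K) →
    All (_∈ keys T) S
    × length S ≤ (3 * n * ((d T ∸ ⌊log₂ n ⌋) + 1)) ⊓ (3 * (n * (n ∸ 1)) / 2)
    × length S ≤ C * (n * d T)
    × (∀ (T₀ : BinTree K) → IsBST T₀ → keys T₀ ∼[ set ] keys T →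
    ∀ (Y : List K) → All (_∈ keys T) Y →
    gf T₀ (S ++ Y) (length S) ≡ T)
theorem6 {a} {ℓ} = 3 , λ {K} {_<_} sto → proof sto
  where
  module _ {K : Set a} {_<_ : Rel K ℓ} (sto : IsStrictTotalOrder _≡_ _<_) where
    open BST sto
    open GreedyFuture sto

    Forced : BinTree K → ℕ → Set _
    Forced T n = ∃ λ (S : List K) →
      All (_∈ keys T) S
      × length S ≤ (3 * n * ((d T ∸ ⌊log₂ n ⌋) + 1)) ⊓ (3 * (n * (n ∸ 1)) / 2)
      × length S ≤ 3 * (n * d T)
      × (∀ (T₀ : BinTree K) → IsBST T₀ → keys T₀ ∼[ set ] keys T →
         ∀ (Y : List K) → All (_∈ keys T) Y →
         gf T₀ (S ++ Y) (length S) ≡ T)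

    forcing-works : ∀ l v r → NonEmpty l ⊎ NonEmpty r → IsBST (node l v r) →
                    Forced (node l v r) (suc (#nodes l + #nodes r))
    forcing-works l v r ne b = forcing l v r , forcing-all l v r ,
      forcing-bound (d (node l v r) ∸ ⌊log₂ suc m ⌋) (nonEmpty-size ne)
        (forcing-length l v r) (forcing-length-2 l v r) ,
      (begin
        length (forcing l v r)                ≤⟨ forcing-length l v r ⟩
        3 * m + 1                             ≤⟨ 3m+1≤3[1+m] m ⟩
        -- At least two keys give d ≥ 1; this is where the constant 3 of the O-bound comes from.
        3 * suc m                             ≤⟨ ℕ.*-monoʳ-≤ 3 (ℕ.m≤m*n (suc m) (d (node l v r))) ⟩
        3 * (suc m * d (node l v r))          ∎) ,
      λ T₀ b₀ same Y _ → trans (gf-run (forcing l v r) Y T₀) (forcing-correct ne b b₀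
        (λ k → ∈-keys⁻ b ∘ Equivalence.to same ∘ ∈-keys⁺) (λ k → ∈-keys⁻ b₀ ∘ Equivalence.from same ∘ ∈-keys⁺) Y)
      where
      open ℕ.≤-Reasoning
      m = #nodes l + #nodes r
      instance
        d≢0 : NonZero (d (node l v r))
        d≢0 = ℕ.>-nonZero (d-positive {l} {v} {r} ne)

    proof : ∀ (n : ℕ) .{{_ : NonZero n}} (T : BinTree K) → IsBST T → #nodes T ≡ n → Forced T n
    proof n (leaf _) b refl = ⊥-elim (ℕ.≢-nonZero⁻¹ n refl)
    -- For one key the quadratic bound is 0, so the sequence is empty: `T₀` already equals `T`.
    proof n (node (leaf _) v (leaf _)) b refl = [] , All.[] , ℕ.z≤n , ℕ.z≤n ,
      λ T₀ b₀ same Y _ → singleton-correct b₀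
        (λ k → ∈-keys⁻ b ∘ Equivalence.to same ∘ ∈-keys⁺) (λ k → ∈-keys⁻ b₀ ∘ Equivalence.from same ∘ ∈-keys⁺)
    proof n (node l@(node _ _ _) v r) b eq =
      subst (Forced (node l v r)) (trans (sym (ℕ.+-suc (#nodes l) (#nodes r))) eq)
        (forcing-works l v r (inj₁ _) b)
    proof n (node (leaf _) v r@(node _ _ _)) b eq =
      subst (Forced (node (leaf _) v r)) eq (forcing-works (leaf _) v r (inj₂ _) b)
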